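{- Let $n$ be a positive integer. Then, for all complex numbers $x,y$ (and either choice of the square root), $$\sum_{k\ge 0}\sum_{p=0}^{n}\binom{n}{p}_k x^p y^k=2^{ -n}\Big[\Big((1+x)(1+y)+\sqrt{(1+x)^2(1+y)^2-4x(1+y)}\Big)^n+\Big((1+x)(1+y)-\sqrt{(1+x)^2(1+y)^2-4x(1+y)}\Big)^n\Big].$$ (Only finitely many terms on the left are nonzero, so this is an identity of polynomials in $x$ and $y$.)
   Context: For $a$ a number and $r\ge 0$ an integer, $(a)_r=a(a+1)\cdots(a+r-1)$ denotes the raising factorial, with $(a)_0=1$. For integers $n\ge 1$, $0\le p\le n$, $k\ge 0$, define $$\binom{n}{p}_k=\binom{n}{k}\;{}_3F_2\!\left[\begin{matrix}1-k,\,-p,\,p-n\\ 1-n,\,1\end{matrix};1\right]=\binom{n}{k}\sum_{r=0}^{\min(p,n-p)}\frac{(1-k)_r\,(-p)_r\,(p-n)_r}{(1-n)_r\,(1)_r\,r!}.$$ The sum is finite because $(-p)_r(p-n)_r=0$ for $r>\min(p,n-p)$, and the denominators are nonzero in the stated range. Here $\binom{n}{k}$ is the usual binomial coefficient, equal to $0$ for $k>n$; hence $\binom{n}{p}_k=0$ for $k>n$. -}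

module Defs where

open import Algebra.Bundles using (CommutativeRing)
import Algebra.Properties.Monoid.Sum as Sum
import Algebra.Properties.Semiring.Exp as Exp
open import Data.Fin.Base using (toℕ)
open import Data.Fin.Properties using (toℕ≤pred[n])
open import Data.Integer.Base as ℤ using (+_)
open import Data.Maybe.Base using (nothing)
open import Data.Nat.Base as ℕ using (ℕ; zero; suc; _∸_; _⊓_; _⊔_; _!)
open import Data.Nat.Combinatorics using (_C_)
import Data.Nat.Properties as ℕP
open import Data.Product.Base using (∃-syntax; _×_; _,_)
open import Data.Rational.Base as ℚ using (ℚ; 0ℚ; 1ℚ; ½; ∣_∣)
import Data.Rational.Properties as ℚP
open import Data.Rational.Solver using (module +-*-Solver)
import Data.Rational.Unnormalised.Base as ℚᵘ
open import Level using (0ℓ)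
open import Relation.Binary.PropositionalEquality
  using (_≡_; _≢_; refl; sym; trans; cong; subst; module ≡-Reasoning)
open import Relation.Nullary.Negation.Core using (contradiction)
import Tactic.RingSolver.Core.AlmostCommutativeRing as ACR
import Tactic.RingSolver.NonReflective as RingSolver

fromℕ : ℕ → ℚ
fromℕ n = + n ℚ./ 1

module _ where
  open import Data.Rational.Base hiding (_⊓_; _⊔_; _≃_)

  infix 9 _⟮_⟯

  _⟮_⟯ : ℚ → ℕ → ℚ
  a ⟮ zero ⟯  = 1ℚ
  a ⟮ suc r ⟯ = a ⟮ r ⟯ * (a + fromℕ r)

  -- The r-th term of ₃F₂(1 - k, -p, p - n; 1 - n, 1; 1) is
  -- numerator n p k r ÷ denominator n r.
  numerator : (n p k r : ℕ) → ℚ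
  numerator n p k r =
    (1ℚ - fromℕ k) ⟮ r ⟯ * (- fromℕ p) ⟮ r ⟯ * (fromℕ p - fromℕ n) ⟮ r ⟯

  denominator : (n r : ℕ) → ℚ
  denominator n r = (1ℚ - fromℕ n) ⟮ r ⟯ * 1ℚ ⟮ r ⟯ * fromℕ (r !)

  private
    fromℕ-injective : ∀ {m n} → fromℕ m ≡ fromℕ n → m ≡ n
    fromℕ-injective {m} {n} eq
      with ℚᵘ.*≡* e ← ℚP./-injective-≃ (ℚᵘ.mkℚᵘ (+ m) 0) (ℚᵘ.mkℚᵘ (+ n) 0) eq
      = trans (sym (ℕP.*-identityʳ m)) (trans (ℤ-injective m n e) (ℕP.*-identityʳ n))
      where
      open import Data.Integer.Properties using (+-injective; pos-*)
      ℤ-injective : ∀ m n → + m ℤ.* + 1 ≡ + n ℤ.* + 1 → m ℕ.* 1 ≡ n ℕ.* 1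
      ℤ-injective m n e = +-injective (trans (pos-* m 1) (trans e (sym (pos-* n 1))))

    fromℕ-suc : ∀ n → fromℕ (suc n) ≡ 1ℚ + fromℕ n
    fromℕ-suc n = ℚP.toℚᵘ-injective
      (ℚᵘP.≃-trans (ℚP.toℚᵘ-fromℚᵘ (ℚᵘ.mkℚᵘ (+ suc n) 0))
      (ℚᵘP.≃-trans (ℚᵘ.*≡* (cong (ℤ._* + 1) (ℤsuc n)))
      (ℚᵘP.≃-trans (ℚᵘP.+-cong {ℚᵘ.1ℚᵘ} ℚᵘP.≃-refl
                     (ℚᵘP.≃-sym (ℚP.toℚᵘ-fromℚᵘ (ℚᵘ.mkℚᵘ (+ n) 0))))
                   (ℚᵘP.≃-sym (ℚP.toℚᵘ-homo-+ 1ℚ (fromℕ n))))))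
      where
      import Data.Rational.Unnormalised.Properties as ℚᵘP
      open import Data.Integer.Properties using (*-identityʳ)
      ℤsuc : ∀ n → + suc n ≡ + 1 ℤ.* + 1 ℤ.+ + n ℤ.* + 1
      ℤsuc n = cong (λ z → + 1 ℤ.+ z) (sym (*-identityʳ (+ n)))

    *-≢0 : ∀ {a b} → a ≢ 0ℚ → b ≢ 0ℚ → a * b ≢ 0ℚ
    *-≢0 {a} {b} a≢0 b≢0 ab≡0 = b≢0 (begin
      b                 ≡⟨ ℚP.*-identityˡ b ⟨
      1ℚ * b            ≡⟨ cong (_* b) (ℚP.*-inverseˡ a) ⟨
      (1/ a) * a * b    ≡⟨ ℚP.*-assoc (1/ a) a b ⟩
      (1/ a) * (a * b)  ≡⟨ cong ((1/ a) *_) ab≡0 ⟩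
      (1/ a) * 0ℚ       ≡⟨ ℚP.*-zeroʳ (1/ a) ⟩
      0ℚ                ∎)
      where
      open ≡-Reasoning
      instance _ = ≢-nonZero a≢0

    ⟮⟯-≢0 : ∀ a r → (∀ j → j ℕ.< r → a + fromℕ j ≢ 0ℚ) → a ⟮ r ⟯ ≢ 0ℚ
    ⟮⟯-≢0 a zero    h ()
    ⟮⟯-≢0 a (suc r) h =
      *-≢0 (⟮⟯-≢0 a r λ j j<r → h j (ℕP.m<n⇒m<1+n j<r)) (h r (ℕP.n<1+n r))

    1-n+j≢0 : ∀ n j → suc j ℕ.< n → 1ℚ - fromℕ n + fromℕ j ≢ 0ℚ
    1-n+j≢0 n j 1+j<n eq = ℕP.<⇒≢ 1+j<n (fromℕ-injective (begin
      fromℕ (suc j)                      ≡⟨ fromℕ-suc j ⟩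
      1ℚ + fromℕ j                       ≡⟨ rearrange (fromℕ n) (fromℕ j) ⟩
      1ℚ - fromℕ n + fromℕ j + fromℕ n   ≡⟨ cong (_+ fromℕ n) eq ⟩
      0ℚ + fromℕ n                       ≡⟨ ℚP.+-identityˡ (fromℕ n) ⟩
      fromℕ n                            ∎))
      where
      open ≡-Reasoning
      open +-*-Solver
      rearrange : ∀ x y → 1ℚ + y ≡ 1ℚ - x + y + x
      rearrange = solve 2 (λ x y → con 1ℚ :+ y := con 1ℚ :- x :+ y :+ x) refl

    1+j≢0 : ∀ j → 1ℚ + fromℕ j ≢ 0ℚ
    1+j≢0 j eq = contradiction (fromℕ-injective {suc j} {0} (trans (fromℕ-suc j) eq)) λ ()

    r<n : ∀ {n p r} → suc r ℕ.≤ p ⊓ (n ∸ p) → suc r ℕ.< n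
    r<n {n} {p} {r} le = ℕP.≤-trans 2+r≤ (ℕP.≤-reflexive (ℕP.m+[n∸m]≡n p≤n))
      where
      1+r≤p : suc r ℕ.≤ p
      1+r≤p = ℕP.m≤n⊓o⇒m≤n p (n ∸ p) le
      1+r≤n∸p : suc r ℕ.≤ n ∸ p
      1+r≤n∸p = ℕP.m≤n⊓o⇒m≤o p (n ∸ p) le
      p≤n : p ℕ.≤ n
      p≤n = ℕP.<⇒≤ (ℕP.m∸n≢0⇒n<m {n} {p}
        λ eq → contradiction (subst (suc r ℕ.≤_) eq 1+r≤n∸p) λ ())
      2+r≤ : suc (suc r) ℕ.≤ p ℕ.+ (n ∸ p)
      2+r≤ = ℕP.≤-trans (ℕP.+-monoˡ-≤ (suc r) (ℕ.s≤s (ℕ.z≤n {r})))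
                       (ℕP.+-mono-≤ 1+r≤p 1+r≤n∸p)

  denominator-nonZero : ∀ n p r → r ℕ.≤ p ⊓ (n ∸ p) → NonZero (denominator n r)
  denominator-nonZero n p r r≤ = ≢-nonZero
    (*-≢0 (*-≢0 (⟮⟯-≢0 (1ℚ - fromℕ n) r λ j j<r → 1-n+j≢0 n j (1+j<n r≤ j<r))
                (⟮⟯-≢0 1ℚ r λ j _ → 1+j≢0 j))
          (λ eq → ℕ.≢-nonZero⁻¹ (r !) ⦃ r ℕP.!≢0 ⦄ (fromℕ-injective {r !} {0} eq)))
    where
    1+j<n : ∀ {r j} → r ℕ.≤ p ⊓ (n ∸ p) → j ℕ.< r → suc j ℕ.< n
    1+j<n {suc r} r≤ j<r = ℕP.≤-<-trans j<r (r<n r≤)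

  -- The numerators vanish for r > p ⊓ (n ∸ p), and the denominators do not
  -- vanish for r ≤ p ⊓ (n ∸ p). Only p ≤ n is meaningful.
  binomial : (n p k : ℕ) → ℚ
  binomial n p k =
    fromℕ (n C k) * ∑[ r ≤ p ⊓ (n ∸ p) ]
      (_÷_ (numerator n p k (toℕ r)) (denominator n (toℕ r))
        ⦃ denominator-nonZero n p (toℕ r) (toℕ≤pred[n] r) ⦄)
    where open Sum ℚP.+-0-monoid

module _ where
  open import Data.Rational.Base hiding (_⊓_; _⊔_; _≃_)

  infix 4 _≃_

  IsCauchy : (ℕ → ℚ) → Set
  IsCauchy f = ∀ ε → 0ℚ < ε →
    ∃[ N ] ∀ m n → N ℕ.≤ m → N ℕ.≤ n → ∣ f m - f n ∣ < ε

  -- Equality of reals is _≃_: the difference is a null sequence.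
  record ℝ : Set where
    constructor mkℝ
    field
      seq    : ℕ → ℚ
      cauchy : IsCauchy seq
  open ℝ

  record _≃_ (x y : ℝ) : Set where
    constructor mk≃
    field
      null : ∀ ε → 0ℚ < ε → ∃[ N ] ∀ n → N ℕ.≤ n → ∣ seq x n - seq y n ∣ < ε
  open _≃_

  private
    opaque
      half-pos : ∀ {ε} → 0ℚ < ε → 0ℚ < ½ * ε
      half-pos {ε} ε>0 = subst (_< ½ * ε) (ℚP.*-zeroʳ ½) (ℚP.*-monoʳ-<-pos ½ ε>0)

    opaque
      half+half : ∀ ε → ½ * ε + ½ * ε ≡ ε
      half+half ε = trans (sym (ℚP.*-distribʳ-+ ε ½ ½)) (ℚP.*-identityˡ ε)

    opaque
      +-small : ∀ {ε} a b → ∣ a ∣ < ½ * ε → ∣ b ∣ < ½ * ε → ∣ a + b ∣ < ε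
      +-small {ε} a b a< b< = ℚP.≤-<-trans (ℚP.∣p+q∣≤∣p∣+∣q∣ a b)
        (subst (∣ a ∣ + ∣ b ∣ <_) (half+half ε) (ℚP.+-mono-< a< b<))

    opaque
      +-sub : ∀ a b c d → (a - c) + (b - d) ≡ (a + b) - (c + d)
      +-sub = solve 4 (λ a b c d → (a :- c) :+ (b :- d) := (a :+ b) :- (c :+ d)) refl
        where open +-*-Solver

    opaque
      *-sub : ∀ a b c d → b * (a - c) + c * (b - d) ≡ a * b - c * d
      *-sub = solve 4 (λ a b c d → b :* (a :- c) :+ c :* (b :- d) := a :* b :- c :* d) refl
        where open +-*-Solver

    opaque
      neg-sub : ∀ a b → - (a - b) ≡ - a - - b
      neg-sub = solve 2 (λ a b → :- (a :- b) := :- a :- :- b) refl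
        where open +-*-Solver

    opaque
      swap-sub : ∀ a b → - (a - b) ≡ b - a
      swap-sub = solve 2 (λ a b → :- (a :- b) := b :- a) refl
        where open +-*-Solver

    opaque
      chain-sub : ∀ a b c → (a - b) + (b - c) ≡ a - c
      chain-sub = solve 3 (λ a b c → (a :- b) :+ (b :- c) := a :- c) refl
        where open +-*-Solver

    opaque
      cancel-sub : ∀ a b → (a - b) + b ≡ a
      cancel-sub = solve 2 (λ a b → (a :- b) :+ b := a) refl
        where open +-*-Solver

    opaque
      neg-small : ∀ {ε} a b → ∣ a - b ∣ < ε → ∣ - a - - b ∣ < ε
      neg-small {ε} a b = subst (_< ε)
        (trans (sym (ℚP.∣-p∣≡∣p∣ (a - b))) (cong ∣_∣ (neg-sub a b)))

    opaque
      swap-small : ∀ {ε} a b → ∣ a - b ∣ < ε → ∣ b - a ∣ < ε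
      swap-small {ε} a b = subst (_< ε)
        (trans (sym (ℚP.∣-p∣≡∣p∣ (a - b))) (cong ∣_∣ (swap-sub a b)))

    opaque
      scale : ∀ B ε → 0ℚ < B → 0ℚ < ε → ∃[ δ ] 0ℚ < δ ×
        (∀ u d → ∣ u ∣ < B → ∣ d ∣ < δ → ∣ u * d ∣ < ε)
      scale B ε B>0 ε>0 = 1/ B * ε , δ>0 , bound
        where
        instance
          B-pos : Positive B
          B-pos = positive B>0
          B-nonNeg : NonNegative B
          B-nonNeg = ℚP.pos⇒nonNeg B
          B-nonZero : NonZero B
          B-nonZero = ℚP.pos⇒nonZero B
          1/B-pos : Positive (1/ B)
          1/B-pos = ℚP.1/pos⇒pos B
        δ>0 : 0ℚ < 1/ B * ε
        δ>0 = subst (_< 1/ B * ε) (ℚP.*-zeroʳ (1/ B)) (ℚP.*-monoʳ-<-pos (1/ B) ε>0)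
        B*δ : B * (1/ B * ε) ≡ ε
        B*δ = trans (sym (ℚP.*-assoc B (1/ B) ε))
          (trans (cong (_* ε) (ℚP.*-inverseʳ B)) (ℚP.*-identityˡ ε))
        bound : ∀ u d → ∣ u ∣ < B → ∣ d ∣ < 1/ B * ε → ∣ u * d ∣ < ε
        bound u d u<B d<δ = begin-strict
          ∣ u * d ∣        ≡⟨ ℚP.∣p*q∣≡∣p∣*∣q∣ u d ⟩
          ∣ u ∣ * ∣ d ∣    ≤⟨ ℚP.*-monoʳ-≤-nonNeg ∣ d ∣ ⦃ ℚP.∣-∣-nonNeg d ⦄ (ℚP.<⇒≤ u<B) ⟩
          B * ∣ d ∣        <⟨ ℚP.*-monoʳ-<-pos B d<δ ⟩
          B * (1/ B * ε)   ≡⟨ B*δ ⟩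
          ε                ∎
          where open ℚP.≤-Reasoning

    opaque
      bounded : ∀ x → ∃[ B ] 0ℚ < B × ∃[ N ] ∀ n → N ℕ.≤ n → ∣ seq x n ∣ < B
      bounded x with N , close ← cauchy x 1ℚ (ℚP.positive⁻¹ 1ℚ)
        = 1ℚ + ∣ seq x N ∣ , B>0 , N , bound
        where
        B>0 : 0ℚ < 1ℚ + ∣ seq x N ∣
        B>0 = ℚP.+-mono-<-≤ (ℚP.positive⁻¹ 1ℚ) (ℚP.0≤∣p∣ (seq x N))
        bound : ∀ n → N ℕ.≤ n → ∣ seq x n ∣ < 1ℚ + ∣ seq x N ∣
        bound n N≤n = begin-strict
          ∣ seq x n ∣                            ≡⟨ cong ∣_∣ (cancel-sub (seq x n) (seq x N)) ⟨
          ∣ seq x n - seq x N + seq x N ∣        ≤⟨ ℚP.∣p+q∣≤∣p∣+∣q∣ (seq x n - seq x N) (seq x N) ⟩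
          ∣ seq x n - seq x N ∣ + ∣ seq x N ∣    <⟨ ℚP.+-monoˡ-< ∣ seq x N ∣ (close n N N≤n ℕP.≤-refl) ⟩
          1ℚ + ∣ seq x N ∣                       ∎
          where open ℚP.≤-Reasoning

    opaque
      split : ∀ {k} m n → m ⊔ n ℕ.≤ k → m ℕ.≤ k × n ℕ.≤ k
      split m n le = ℕP.m⊔n≤o⇒m≤o m n le , ℕP.m⊔n≤o⇒n≤o m n le

    opaque
      split₄ : ∀ {k} m n m′ n′ → (m ⊔ n) ⊔ (m′ ⊔ n′) ℕ.≤ k →
               (m ℕ.≤ k × n ℕ.≤ k) × (m′ ℕ.≤ k × n′ ℕ.≤ k)
      split₄ m n m′ n′ le =
          split m n (ℕP.m⊔n≤o⇒m≤o (m ⊔ n) (m′ ⊔ n′) le)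
        , split m′ n′ (ℕP.m⊔n≤o⇒n≤o (m ⊔ n) (m′ ⊔ n′) le)

  opaque
    const-cauchy : ∀ q → IsCauchy (λ _ → q)
    const-cauchy q ε ε>0 = 0 , λ _ _ _ _ → subst (_< ε) (cong ∣_∣ (sym (ℚP.+-inverseʳ q))) ε>0

  opaque
    +-cauchy : ∀ x y → IsCauchy (λ n → seq x n + seq y n)
    +-cauchy x y ε ε>0
      with N₁ , close₁ ← cauchy x (½ * ε) (half-pos ε>0)
         | N₂ , close₂ ← cauchy y (½ * ε) (half-pos ε>0)
      = N₁ ⊔ N₂ , λ m n N≤m N≤n →
          let N₁≤m , N₂≤m = split N₁ N₂ N≤m
              N₁≤n , N₂≤n = split N₁ N₂ N≤n
          in subst (_< ε) (cong ∣_∣ (+-sub (seq x m) (seq y m) (seq x n) (seq y n)))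
            (+-small (seq x m - seq x n) (seq y m - seq y n)
              (close₁ m n N₁≤m N₁≤n) (close₂ m n N₂≤m N₂≤n))

  opaque
    neg-cauchy : ∀ x → IsCauchy (λ n → - seq x n)
    neg-cauchy x ε ε>0 with N , close ← cauchy x ε ε>0
      = N , λ m n N≤m N≤n → neg-small (seq x m) (seq x n) (close m n N≤m N≤n)

  opaque
    *-cauchy : ∀ x y → IsCauchy (λ n → seq x n * seq y n)
    *-cauchy x y ε ε>0
      with B₁ , B₁>0 , M₁ , bound₁ ← bounded x
         | B₂ , B₂>0 , M₂ , bound₂ ← bounded y
      with δ₁ , δ₁>0 , small₁ ← scale B₁ (½ * ε) B₁>0 (half-pos ε>0)
         | δ₂ , δ₂>0 , small₂ ← scale B₂ (½ * ε) B₂>0 (half-pos ε>0)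
      with N₁ , close₁ ← cauchy x δ₂ δ₂>0
         | N₂ , close₂ ← cauchy y δ₁ δ₁>0
      = (M₁ ⊔ M₂) ⊔ (N₁ ⊔ N₂) , λ m n N≤m N≤n →
          let (M₁≤m , M₂≤m) , N₁≤m , N₂≤m = split₄ M₁ M₂ N₁ N₂ N≤m
              (M₁≤n , M₂≤n) , N₁≤n , N₂≤n = split₄ M₁ M₂ N₁ N₂ N≤n
          in subst (_< ε) (cong ∣_∣ (*-sub (seq x m) (seq y m) (seq x n) (seq y n)))
            (+-small (seq y m * (seq x m - seq x n)) (seq x n * (seq y m - seq y n))
              (small₂ (seq y m) (seq x m - seq x n)
                (bound₂ m M₂≤m)
                (close₁ m n N₁≤m N₁≤n))
              (small₁ (seq x n) (seq y m - seq y n)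
                (bound₁ n M₁≤n)
                (close₂ m n N₂≤m N₂≤n)))

  infixl 6 _+ᴿ_
  infixl 7 _*ᴿ_
  infix  8 -ᴿ_

  _+ᴿ_ : ℝ → ℝ → ℝ
  x +ᴿ y = mkℝ (λ n → seq x n + seq y n) (+-cauchy x y)

  -ᴿ_ : ℝ → ℝ
  -ᴿ x = mkℝ (λ n → - seq x n) (neg-cauchy x)

  _*ᴿ_ : ℝ → ℝ → ℝ
  x *ᴿ y = mkℝ (λ n → seq x n * seq y n) (*-cauchy x y)

  fromℚ-ℝ : ℚ → ℝ
  fromℚ-ℝ q = mkℝ (λ _ → q) (const-cauchy q)

  opaque
    ≃-pointwise : ∀ {x y} → (∀ n → seq x n ≡ seq y n) → x ≃ y
    ≃-pointwise {x} {y} eq .null ε ε>0 = 0 , λ n _ →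
      subst (_< ε) (cong ∣_∣ (sym (trans (cong (_- seq y n) (eq n)) (ℚP.+-inverseʳ (seq y n))))) ε>0

  opaque
    ≃-sym : ∀ {x y} → x ≃ y → y ≃ x
    ≃-sym {x} {y} x≃y .null ε ε>0 with N , close ← null x≃y ε ε>0
      = N , λ n N≤n → swap-small (seq x n) (seq y n) (close n N≤n)

  opaque
    ≃-trans : ∀ {x y z} → x ≃ y → y ≃ z → x ≃ z
    ≃-trans {x} {y} {z} x≃y y≃z .null ε ε>0
      with N₁ , close₁ ← null x≃y (½ * ε) (half-pos ε>0)
         | N₂ , close₂ ← null y≃z (½ * ε) (half-pos ε>0)
      = N₁ ⊔ N₂ , λ n N≤n →
          let N₁≤n , N₂≤n = split N₁ N₂ N≤n
          in subst (_< ε) (cong ∣_∣ (chain-sub (seq x n) (seq y n) (seq z n)))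
            (+-small (seq x n - seq y n) (seq y n - seq z n) (close₁ n N₁≤n) (close₂ n N₂≤n))

  opaque
    +-cong : ∀ {x x′ y y′} → x ≃ x′ → y ≃ y′ → x +ᴿ y ≃ x′ +ᴿ y′
    +-cong {x} {x′} {y} {y′} x≃x′ y≃y′ .null ε ε>0
      with N₁ , close₁ ← null x≃x′ (½ * ε) (half-pos ε>0)
         | N₂ , close₂ ← null y≃y′ (½ * ε) (half-pos ε>0)
      = N₁ ⊔ N₂ , λ n N≤n →
          let N₁≤n , N₂≤n = split N₁ N₂ N≤n
          in subst (_< ε) (cong ∣_∣ (+-sub (seq x n) (seq y n) (seq x′ n) (seq y′ n)))
            (+-small (seq x n - seq x′ n) (seq y n - seq y′ n) (close₁ n N₁≤n) (close₂ n N₂≤n))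

  opaque
    neg-cong : ∀ {x y} → x ≃ y → -ᴿ x ≃ -ᴿ y
    neg-cong {x} {y} x≃y .null ε ε>0 with N , close ← null x≃y ε ε>0
      = N , λ n N≤n → neg-small (seq x n) (seq y n) (close n N≤n)

  opaque
    *-cong : ∀ {x x′ y y′} → x ≃ x′ → y ≃ y′ → x *ᴿ y ≃ x′ *ᴿ y′
    *-cong {x} {x′} {y} {y′} x≃x′ y≃y′ .null ε ε>0
      with B₁ , B₁>0 , M₁ , bound₁ ← bounded x′
         | B₂ , B₂>0 , M₂ , bound₂ ← bounded y
      with δ₁ , δ₁>0 , small₁ ← scale B₁ (½ * ε) B₁>0 (half-pos ε>0)
         | δ₂ , δ₂>0 , small₂ ← scale B₂ (½ * ε) B₂>0 (half-pos ε>0)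
      with N₁ , close₁ ← null x≃x′ δ₂ δ₂>0
         | N₂ , close₂ ← null y≃y′ δ₁ δ₁>0
      = (M₁ ⊔ M₂) ⊔ (N₁ ⊔ N₂) , λ n N≤n →
          let (M₁≤n , M₂≤n) , N₁≤n , N₂≤n = split₄ M₁ M₂ N₁ N₂ N≤n
          in subst (_< ε) (cong ∣_∣ (*-sub (seq x n) (seq y n) (seq x′ n) (seq y′ n)))
            (+-small (seq y n * (seq x n - seq x′ n)) (seq x′ n * (seq y n - seq y′ n))
              (small₂ (seq y n) (seq x n - seq x′ n)
                (bound₂ n M₂≤n) (close₁ n N₁≤n))
              (small₁ (seq x′ n) (seq y n - seq y′ n)
                (bound₁ n M₁≤n) (close₂ n N₂≤n)))

  ℝ-commutativeRing : CommutativeRing 0ℓ 0ℓ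
  ℝ-commutativeRing = record
    { Carrier = ℝ
    ; _≈_ = _≃_
    ; _+_ = _+ᴿ_
    ; _*_ = _*ᴿ_
    ; -_ = -ᴿ_
    ; 0# = fromℚ-ℝ 0ℚ
    ; 1# = fromℚ-ℝ 1ℚ
    ; isCommutativeRing = record
      { isRing = record
        { +-isAbelianGroup = record
          { isGroup = record
            { isMonoid = record
              { isSemigroup = record
                { isMagma = record
                  { isEquivalence = record
                    { refl = ≃-pointwise λ _ → refl ; sym = ≃-sym ; trans = ≃-trans }
                  ; ∙-cong = +-cong
                  }
                ; assoc = λ x y z → ≃-pointwise λ n → ℚP.+-assoc (seq x n) (seq y n) (seq z n)
                }
              ; identity = (λ x → ≃-pointwise λ n → ℚP.+-identityˡ (seq x n))
                         , (λ x → ≃-pointwise λ n → ℚP.+-identityʳ (seq x n))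
              }
            ; inverse = (λ x → ≃-pointwise λ n → ℚP.+-inverseˡ (seq x n))
                      , (λ x → ≃-pointwise λ n → ℚP.+-inverseʳ (seq x n))
            ; ⁻¹-cong = neg-cong
            }
          ; comm = λ x y → ≃-pointwise λ n → ℚP.+-comm (seq x n) (seq y n)
          }
        ; *-cong = *-cong
        ; *-assoc = λ x y z → ≃-pointwise λ n → ℚP.*-assoc (seq x n) (seq y n) (seq z n)
        ; *-identity = (λ x → ≃-pointwise λ n → ℚP.*-identityˡ (seq x n))
                     , (λ x → ≃-pointwise λ n → ℚP.*-identityʳ (seq x n))
        ; distrib = (λ x y z → ≃-pointwise λ n → ℚP.*-distribˡ-+ (seq x n) (seq y n) (seq z n))
                  , (λ x y z → ≃-pointwise λ n → ℚP.*-distribʳ-+ (seq x n) (seq y n) (seq z n))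
        }
      ; *-comm = λ x y → ≃-pointwise λ n → ℚP.*-comm (seq x n) (seq y n)
      }
    }

-- The pair (a , b) stands for a + b i, with i² = -1.
adjoin-i : ∀ {c ℓ} → CommutativeRing c ℓ → CommutativeRing c ℓ
adjoin-i R = record
  { Carrier = Carrier × Carrier
  ; _≈_ = λ (a , b) (c , d) → a ≈ c × b ≈ d
  ; _+_ = λ (a , b) (c , d) → a + c , b + d
  ; _*_ = λ (a , b) (c , d) → a * c - b * d , a * d + b * c
  ; -_ = λ (a , b) → - a , - b
  ; 0# = 0# , 0#
  ; 1# = 1# , 0#
  ; isCommutativeRing = record
    { isRing = record
      { +-isAbelianGroup = record
        { isGroup = record
          { isMonoid = record
            { isSemigroup = record
              { isMagma = record
                { isEquivalence = record
                  { refl = R.refl , R.refl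
                  ; sym = λ (p , q) → R.sym p , R.sym q
                  ; trans = λ (p , q) (r , s) → R.trans p r , R.trans q s
                  }
                ; ∙-cong = λ (p , q) (r , s) → R.+-cong p r , R.+-cong q s
                }
              ; assoc = λ (a , b) (c , d) (e , f) → R.+-assoc a c e , R.+-assoc b d f
              }
            ; identity = (λ (a , b) → R.+-identityˡ a , R.+-identityˡ b)
                       , (λ (a , b) → R.+-identityʳ a , R.+-identityʳ b)
            }
          ; inverse = (λ (a , b) → R.-‿inverseˡ a , R.-‿inverseˡ b)
                    , (λ (a , b) → R.-‿inverseʳ a , R.-‿inverseʳ b)
          ; ⁻¹-cong = λ (p , q) → R.-‿cong p , R.-‿cong q
          }
        ; comm = λ (a , b) (c , d) → R.+-comm a c , R.+-comm b d
        }
      ; *-cong = λ (p , q) (r , s) →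
            R.+-cong (R.*-cong p r) (R.-‿cong (R.*-cong q s))
          , R.+-cong (R.*-cong p s) (R.*-cong q r)
      ; *-assoc = λ (a , b) (c , d) (e , f) → assoc-re a b c d e f , assoc-im a b c d e f
      ; *-identity = (λ (a , b) → idˡ-re a b , idˡ-im a b)
                   , (λ (a , b) → idʳ-re a b , idʳ-im a b)
      ; distrib = (λ (a , b) (c , d) (e , f) → distˡ-re a b c d e f , distˡ-im a b c d e f)
                , (λ (a , b) (c , d) (e , f) → distʳ-re a b c d e f , distʳ-im a b c d e f)
      }
    ; *-comm = λ (a , b) (c , d) → comm-re a b c d , comm-im a b c d
    }
  }
  where
  module R = CommutativeRing R
  open R using (Carrier; _≈_; _+_; _*_; -_; _-_; 0#; 1#)
  open RingSolver (ACR.fromCommutativeRing R (λ _ → nothing))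
    using (solve; _⊜_; _⊕_; _⊗_; ⊝_)
  open import Algebra.Properties.Ring R.ring using (-0#≈0#; [y-z]x≈yx-zx; x[y-z]≈xy-xz)
  open import Relation.Binary.Reasoning.Setoid R.setoid

  opaque
    assoc-re : ∀ a b c d e f →
      (a * c - b * d) * e - (a * d + b * c) * f ≈ a * (c * e - d * f) - b * (c * f + d * e)
    assoc-re a b c d e f = begin
      (a * c - b * d) * e - (a * d + b * c) * f
        ≈⟨ R.+-cong ([y-z]x≈yx-zx e (a * c) (b * d)) (R.-‿cong (R.distribʳ f (a * d) (b * c))) ⟩
      (a * c * e - b * d * e) - (a * d * f + b * c * f)
        ≈⟨ solve 4 (λ p q r s → ((p ⊕ ⊝ q) ⊕ ⊝ (r ⊕ s)) ⊜ ((p ⊕ ⊝ r) ⊕ ⊝ (s ⊕ q))) R.refl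
             (a * c * e) (b * d * e) (a * d * f) (b * c * f) ⟩
      (a * c * e - a * d * f) - (b * c * f + b * d * e)
        ≈⟨ R.+-cong (R.+-cong (R.*-assoc a c e) (R.-‿cong (R.*-assoc a d f)))
                    (R.-‿cong (R.+-cong (R.*-assoc b c f) (R.*-assoc b d e))) ⟩
      (a * (c * e) - a * (d * f)) - (b * (c * f) + b * (d * e))
        ≈⟨ R.+-cong (x[y-z]≈xy-xz a (c * e) (d * f)) (R.-‿cong (R.distribˡ b (c * f) (d * e))) ⟨
      a * (c * e - d * f) - b * (c * f + d * e) ∎

    assoc-im : ∀ a b c d e f →
      (a * c - b * d) * f + (a * d + b * c) * e ≈ a * (c * f + d * e) + b * (c * e - d * f)
    assoc-im a b c d e f = begin
      (a * c - b * d) * f + (a * d + b * c) * e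
        ≈⟨ R.+-cong ([y-z]x≈yx-zx f (a * c) (b * d)) (R.distribʳ e (a * d) (b * c)) ⟩
      (a * c * f - b * d * f) + (a * d * e + b * c * e)
        ≈⟨ solve 4 (λ p q r s → ((p ⊕ ⊝ q) ⊕ (r ⊕ s)) ⊜ ((p ⊕ r) ⊕ (s ⊕ ⊝ q))) R.refl
             (a * c * f) (b * d * f) (a * d * e) (b * c * e) ⟩
      (a * c * f + a * d * e) + (b * c * e - b * d * f)
        ≈⟨ R.+-cong (R.+-cong (R.*-assoc a c f) (R.*-assoc a d e))
                    (R.+-cong (R.*-assoc b c e) (R.-‿cong (R.*-assoc b d f))) ⟩
      (a * (c * f) + a * (d * e)) + (b * (c * e) - b * (d * f))
        ≈⟨ R.+-cong (R.distribˡ a (c * f) (d * e)) (x[y-z]≈xy-xz b (c * e) (d * f)) ⟨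
      a * (c * f + d * e) + b * (c * e - d * f) ∎

    comm-re : ∀ a b c d → a * c - b * d ≈ c * a - d * b
    comm-re a b c d = R.+-cong (R.*-comm a c) (R.-‿cong (R.*-comm b d))

    comm-im : ∀ a b c d → a * d + b * c ≈ c * b + d * a
    comm-im a b c d =
      R.trans (R.+-comm (a * d) (b * c)) (R.+-cong (R.*-comm b c) (R.*-comm a d))

    idˡ-re : ∀ a b → 1# * a - 0# * b ≈ a
    idˡ-re a b = R.trans
      (R.+-cong (R.*-identityˡ a) (R.trans (R.-‿cong (R.zeroˡ b)) -0#≈0#))
      (R.+-identityʳ a)

    idˡ-im : ∀ a b → 1# * b + 0# * a ≈ b
    idˡ-im a b = R.trans (R.+-cong (R.*-identityˡ b) (R.zeroˡ a)) (R.+-identityʳ b)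

    idʳ-re : ∀ a b → a * 1# - b * 0# ≈ a
    idʳ-re a b = R.trans (comm-re a b 1# 0#) (idˡ-re a b)

    idʳ-im : ∀ a b → a * 0# + b * 1# ≈ b
    idʳ-im a b = R.trans (comm-im a b 1# 0#) (idˡ-im a b)

    distˡ-re : ∀ a b c d e f →
      a * (c + e) - b * (d + f) ≈ (a * c - b * d) + (a * e - b * f)
    distˡ-re = solve 6 (λ a b c d e f →
      (a ⊗ (c ⊕ e) ⊕ ⊝ (b ⊗ (d ⊕ f))) ⊜
      ((a ⊗ c ⊕ ⊝ (b ⊗ d)) ⊕ (a ⊗ e ⊕ ⊝ (b ⊗ f)))) R.refl

    distˡ-im : ∀ a b c d e f →
      a * (d + f) + b * (c + e) ≈ (a * d + b * c) + (a * f + b * e)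
    distˡ-im = solve 6 (λ a b c d e f →
      (a ⊗ (d ⊕ f) ⊕ b ⊗ (c ⊕ e)) ⊜
      ((a ⊗ d ⊕ b ⊗ c) ⊕ (a ⊗ f ⊕ b ⊗ e))) R.refl

    distʳ-re : ∀ a b c d e f →
      (c + e) * a - (d + f) * b ≈ (c * a - d * b) + (e * a - f * b)
    distʳ-re = solve 6 (λ a b c d e f →
      ((c ⊕ e) ⊗ a ⊕ ⊝ ((d ⊕ f) ⊗ b)) ⊜
      ((c ⊗ a ⊕ ⊝ (d ⊗ b)) ⊕ (e ⊗ a ⊕ ⊝ (f ⊗ b)))) R.refl

    distʳ-im : ∀ a b c d e f →
      (c + e) * b + (d + f) * a ≈ (c * b + d * a) + (e * b + f * a)
    distʳ-im = solve 6 (λ a b c d e f →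
      ((c ⊕ e) ⊗ b ⊕ (d ⊕ f) ⊗ a) ⊜
      ((c ⊗ b ⊕ d ⊗ a) ⊕ (e ⊗ b ⊕ f ⊗ a))) R.refl

ℂ-commutativeRing : CommutativeRing 0ℓ 0ℓ
ℂ-commutativeRing = adjoin-i ℝ-commutativeRing

module ℂ where
  open CommutativeRing ℂ-commutativeRing public
  open Exp semiring public using (_^_)
  open Sum +-monoid public using (sum; sum-syntax; sum⁺-syntax)

open ℂ public using () renaming (Carrier to ℂ)

fromℚ : ℚ → ℂ
fromℚ q = fromℚ-ℝ q , fromℚ-ℝ 0ℚ

-- Σ_{k ≥ 0} f k = s, for a family f with only finitely many nonzero terms.
infix 4 _SumsTo_
_SumsTo_ : (ℕ → ℂ) → ℂ → Set
f SumsTo s = ∃[ K ] (∀ k → K ℕ.≤ k → f k ℂ.≈ ℂ.0#) × ℂ.sum {K} (λ k → f (toℕ k)) ℂ.≈ s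

{-# OPTIONS --safe #-}

-- Let Y = 1 + y, and let α, β be the two values ½ ((1 + x) Y ± s), so that
-- α + β = (1 + x) Y and α β = x Y. The right-hand side is αⁿ + βⁿ = hₙ - α β hₙ₋₂, where
-- hₙ = Σ αⁱ βⁿ⁻ⁱ satisfies hₙ₊₂ = (1 + x) Y hₙ₊₁ - x Y hₙ. The polynomials
-- Σ_{p + q = n} x^p G(p,q), with G(p,q) = Σ_r C(p,r) C(q,r) y^r Y^(p+q-r), satisfy the same
-- recurrence by Pascal's rule in p and in q. Hence the coefficient of x^p y^k in αⁿ + βⁿ,
-- with q = n - p and j = n - k, is
--   Σ_r C(p,r) C(q,r) C(n-r,j) - Σ_r C(p-1,r) C(q-1,r) C(n-1-r,j-1).
-- For k > 0, multiplying the hypergeometric sum by k turns it into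
-- n Σ_r C(p,r) C(q,r) C(n-1-r,j), and the two expressions agree by a telescoping argument.
-- For k = 0 the sum is evaluated by Gosper's antidifference.
module Submission where

open import Defs using
  (fromℕ; _⟮_⟯; numerator; denominator; denominator-nonZero; binomial;
   ≃-pointwise; ℂ-commutativeRing; module ℂ; ℂ; fromℚ; _SumsTo_)
open import Algebra.Bundles using (CommutativeMonoid; CommutativeRing)
open import Data.Fin.Base using (Fin; toℕ)
open import Data.Fin.Properties using (toℕ≤pred[n])
open import Data.Nat.Base as ℕ
  using (ℕ; zero; suc; NonZero; _∸_; _⊓_; _≤_; z≤n; s≤s; _!)
open import Data.Nat.Combinatorics
  using (_C_; nCk+nC[k+1]≡[n+1]C[k+1]; k>n⇒nCk≡0; nCn≡1; nCk≡nC[n∸k])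
import Data.Nat.Properties as ℕP
import Data.Nat.Tactic.RingSolver as ℕSolver
open import Data.Product.Base using (_,_)
open import Data.Rational.Base as ℚ using (ℚ; 0ℚ; 1ℚ; ½)
import Data.Rational.Properties as ℚP
open import Relation.Binary.PropositionalEquality as ≡ using (_≡_)
open import Relation.Nullary using (yes; no)
open import Relation.Nullary.Negation using (contradiction)

-- `G` comes from a bivariate series: Σ G(p,q) u^p v^q = 1/((1 - Yu)(1 - Yv) - yYuv), and since Y² -
-- yY = Y the denominator is 1 - Y(u + v) + Yuv. Setting u = xz, v = z turns it into 1 - (1 + x)Yz +
-- xYz² = (1 - αz)(1 - βz), whose reciprocal generates the hₙ; this is why the two recurrences
-- coincide. The index j = n - k replaces k because the coefficient of y^k in y^r Y^(n-r) is
-- C(n-r,k-r) = C(n-r,j): with j no truncated k - r appears, and r > k gives 0 automatically.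
-- Multiplication by k is what gives k C(n,k) (1-k)_r / (1-n)_r the form n C(n-1-r,j); at k = 0 it
-- loses all information, so that case needs an evaluation of its own. Neither ℕ nor the semiring
-- solver has negatives. Differences are therefore mostly carried as added terms on the other side
-- and cancelled later.

-- Finite sums over initial segments and antidiagonals.

module FiniteSums {c ℓ} (M : CommutativeMonoid c ℓ) where
  open CommutativeMonoid M
    renaming (_∙_ to _+_; ε to 0#; ∙-cong to +-cong; ∙-congˡ to +-congˡ; ∙-congʳ to +-congʳ;
              identityˡ to +-identityˡ; identityʳ to +-identityʳ; assoc to +-assoc)
  open import Algebra.Properties.CommutativeMonoid.Sum M public
  open import Relation.Binary.Reasoning.Setoid setoid

  ∑-cong : ∀ n {f g : ℕ → Carrier} → (∀ i → i ℕ.< n → f i ≈ g i) →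
           ∑[ i < n ] f (toℕ i) ≈ ∑[ i < n ] g (toℕ i)
  ∑-cong zero    f≈g = refl
  ∑-cong (suc n) f≈g = +-cong (f≈g 0 (s≤s z≤n)) (∑-cong n λ i i<n → f≈g (suc i) (s≤s i<n))

  ∑-zero : ∀ n {f : ℕ → Carrier} → (∀ i → f i ≈ 0#) → ∑[ i < n ] f (toℕ i) ≈ 0#
  ∑-zero n f≈0 = trans (∑-cong n λ i _ → f≈0 i) (sum-replicate-zero n)

  ∑-last : ∀ n (f : ℕ → Carrier) → ∑[ i ≤ n ] f (toℕ i) ≈ ∑[ i < n ] f (toℕ i) + f n
  ∑-last zero    f = trans (+-identityʳ (f 0)) (sym (+-identityˡ (f 0)))
  ∑-last (suc n) f = trans (+-congˡ (∑-last n (λ i → f (suc i)))) (sym (+-assoc _ _ _))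

  -- The vanishing term at `suc n` is appended before the term at 0 is split off, so both sums keep
  -- the range `i ≤ n`.
  ∑-shift : ∀ n (f : ℕ → Carrier) → f (suc n) ≈ 0# →
            ∑[ i ≤ n ] f (toℕ i) ≈ f 0 + ∑[ i ≤ n ] f (suc (toℕ i))
  ∑-shift n f f≈0 = sym (begin
    ∑[ i ≤ suc n ] f (toℕ i)         ≈⟨ ∑-last (suc n) f ⟩
    ∑[ i ≤ n ] f (toℕ i) + f (suc n) ≈⟨ +-congˡ f≈0 ⟩
    ∑[ i ≤ n ] f (toℕ i) + 0#        ≈⟨ +-identityʳ _ ⟩
    ∑[ i ≤ n ] f (toℕ i)             ∎)

  ∑-truncate : ∀ {m n} (f : ℕ → Carrier) → m ≤ n → (∀ i → m ≤ i → f i ≈ 0#) →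
               ∑[ i < n ] f (toℕ i) ≈ ∑[ i < m ] f (toℕ i)
  ∑-truncate {n = n} f z≤n       f≈0 = ∑-zero n λ i → f≈0 i z≤n
  ∑-truncate         f (s≤s m≤n) f≈0 =
    +-congˡ (∑-truncate (λ i → f (suc i)) m≤n λ i m≤i → f≈0 (suc i) (s≤s m≤i))

  antidiagonal : ℕ → (ℕ → ℕ → Carrier) → Carrier
  antidiagonal n f = ∑[ i ≤ n ] f (toℕ i) (n ∸ toℕ i)

  antidiagonal-cong : ∀ n {f g : ℕ → ℕ → Carrier} → (∀ i j → i ℕ.+ j ≡ n → f i j ≈ g i j) →
                      antidiagonal n f ≈ antidiagonal n g
  antidiagonal-cong n f≈g =
    ∑-cong (suc n) λ { i (s≤s i≤n) → f≈g i (n ∸ i) (ℕP.m+[n∸m]≡n i≤n) }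

  antidiagonal-+ : ∀ n (f g : ℕ → ℕ → Carrier) →
    antidiagonal n (λ i j → f i j + g i j) ≈ antidiagonal n f + antidiagonal n g
  antidiagonal-+ n f g =
    ∑-distrib-+ {suc n} (λ i → f (toℕ i) (n ∸ toℕ i)) (λ i → g (toℕ i) (n ∸ toℕ i))

  antidiagonal-last : ∀ n (f : ℕ → ℕ → Carrier) →
    antidiagonal (suc n) f ≈ antidiagonal n (λ i j → f i (suc j)) + f (suc n) 0
  antidiagonal-last zero    f = trans (sym (+-assoc _ _ _))
    (trans (+-identityʳ _) (+-congʳ (sym (+-identityʳ _))))
  antidiagonal-last (suc n) f =
    trans (+-congˡ (antidiagonal-last n (λ i j → f (suc i) j))) (sym (+-assoc _ _ _))

-- Identities between binomial coefficients in ℕ.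

pascal : ∀ n k → suc n C suc k ≡ n C k ℕ.+ n C suc k
pascal n k = ≡.sym (nCk+nC[k+1]≡[n+1]C[k+1] n k)

infixl 6.5 _C⁻_
-- C(n,k-1) with the value 0 at k = 0, so that Pascal's rule holds for every k without a case
-- distinction.
_C⁻_ : ℕ → ℕ → ℕ
n C⁻ zero  = 0
n C⁻ suc k = n C k

pascal⁻ : ∀ n k → suc n C k ≡ n C k ℕ.+ n C⁻ k
pascal⁻ n zero    = ≡.refl
pascal⁻ n (suc k) = ≡.trans (pascal n k) (ℕP.+-comm (n C k) (n C suc k))

module _ where
  open import Data.Nat.Base using (_+_; _*_)
  open ≡ using (refl; sym; trans; cong; cong₂)
  open ≡.≡-Reasoning

  absorption : ∀ n k → suc k * (suc n C suc k) ≡ suc n * (n C k)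
  absorption zero    zero    = refl
  absorption zero    (suc k) = ℕP.*-zeroʳ k
  absorption (suc n) k = begin
    suc k * (suc (suc n) C suc k)
      ≡⟨ cong (suc k *_) (pascal (suc n) k) ⟩
    suc k * (suc n C k + suc n C suc k)
      ≡⟨ ℕP.*-distribˡ-+ (suc k) (suc n C k) (suc n C suc k) ⟩
    suc k * (suc n C k) + suc k * (suc n C suc k)
      ≡⟨ cong₂ _+_ (lower k) (absorption n k) ⟩
    (suc n * (n C⁻ k) + suc n C k) + suc n * (n C k)
      ≡⟨ cong (λ c → suc n * (n C⁻ k) + c + suc n * (n C k)) (pascal⁻ n k) ⟩
    (suc n * (n C⁻ k) + (n C k + n C⁻ k)) + suc n * (n C k)
      ≡⟨ rearrange n (n C k) (n C⁻ k) ⟩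
    suc (suc n) * (n C k + n C⁻ k)
      ≡⟨ cong (suc (suc n) *_) (pascal⁻ n k) ⟨
    suc (suc n) * (suc n C k) ∎
    where
    -- The induction hypothesis at k - 1, with `C⁻` covering k = 0.
    lower : ∀ k → suc k * (suc n C k) ≡ suc n * (n C⁻ k) + suc n C k
    lower zero    = cong (_+ 1) (sym (ℕP.*-zeroʳ n))
    lower (suc k) = trans (ℕP.+-comm (suc n C suc k) _)
                          (cong (_+ suc n C suc k) (absorption n k))
    rearrange : ∀ n a b → (suc n * b + (a + b)) + suc n * a ≡ suc (suc n) * (a + b)
    rearrange = ℕSolver.solve-∀

  absorption-complement : ∀ n k →
    suc n * (suc n C k) ≡ k * (suc n C k) + suc n * (n C k)
  absorption-complement n zero    = refl
  absorption-complement n (suc k) = begin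
    suc n * (suc n C suc k)
      ≡⟨ cong (suc n *_) (pascal n k) ⟩
    suc n * (n C k + n C suc k)
      ≡⟨ ℕP.*-distribˡ-+ (suc n) (n C k) (n C suc k) ⟩
    suc n * (n C k) + suc n * (n C suc k)
      ≡⟨ cong (_+ suc n * (n C suc k)) (absorption n k) ⟨
    suc k * (suc n C suc k) + suc n * (n C suc k) ∎

  C-sym : ∀ {m} k j → k + j ≡ m → m C k ≡ m C j
  C-sym k j refl = trans (nCk≡nC[n∸k] (ℕP.m≤m+n k j))
    (cong ((k + j) C_) (ℕP.m+n∸m≡n k j))

  absorption-reflected : ∀ m k j → suc k + j ≡ suc m →
    suc k * (suc m C suc k) ≡ suc m * (m C j)
  absorption-reflected m k j e = trans (absorption m k)
    (cong (suc m *_) (C-sym k j (ℕP.suc-injective e)))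

  -- The ratio (n - k) : (k + 1) of neighbours in a row, with the subtraction moved across.
  descent : ∀ n k → suc k * (n C suc k) + k * (n C k) ≡ n * (n C k)
  descent n k = ℕP.+-cancelʳ-≡ (n C k) _ _ (begin
    suc k * (n C suc k) + k * (n C k) + n C k  ≡⟨ rearrange k (n C k) (n C suc k) ⟩
    suc k * (n C k + n C suc k)                ≡⟨ cong (suc k *_) (pascal n k) ⟨
    suc k * (suc n C suc k)                    ≡⟨ absorption n k ⟩
    suc n * (n C k)                            ≡⟨ ℕP.+-comm (n C k) (n * (n C k)) ⟩
    n * (n C k) + n C k                        ∎)
    where
    rearrange : ∀ k a b → suc k * b + k * a + a ≡ suc k * (a + b)
    rearrange = ℕSolver.solve-∀

  -- Here k = r + (N + 1 - j). The part N + 1 - j is absorbed into (N + 1) C(N,j), and Pascal's rule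
  -- splits the part r.
  C-split : ∀ N j k {r n} → suc N + r ≡ n → k + j ≡ n →
            k * (suc N C j) ≡ n * (N C j) + r * (N C⁻ j)
  C-split N zero k {r} refl e = begin
    k * 1                    ≡⟨ cong (_* 1) (trans (sym (ℕP.+-identityʳ k)) e) ⟩
    (suc N + r) * 1          ≡⟨ ℕP.+-identityʳ _ ⟨
    (suc N + r) * 1 + 0      ≡⟨ cong ((suc N + r) * 1 +_) (ℕP.*-zeroʳ r) ⟨
    (suc N + r) * 1 + r * 0  ∎
  C-split N (suc i) k {r} refl e = ℕP.+-cancelʳ-≡ (i * a) _ _ (begin
    k * (suc N C suc i) + i * a                ≡⟨ cong (λ c → k * c + i * a) (pascal N i) ⟩
    k * (a + b) + i * a                        ≡⟨ rearrange₁ k i a b ⟩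
    (k + i) * a + k * b                        ≡⟨ cong (λ m → m * a + k * b) k+i≡N+r ⟩
    (N + r) * a + k * b                        ≡⟨ rearrange₂ N r k a b ⟩
    N * a + (r * a + k * b)                    ≡⟨ cong (_+ (r * a + k * b)) (descent N i) ⟨
    suc i * b + i * a + (r * a + k * b)        ≡⟨ rearrange₃ i r k a b ⟩
    (k + suc i) * b + r * a + i * a            ≡⟨ cong (λ m → m * b + r * a + i * a) e ⟩
    (suc N + r) * b + r * a + i * a            ∎)
    where
    a = N C i
    b = N C suc i
    k+i≡N+r : k + i ≡ N + r
    k+i≡N+r = ℕP.suc-injective (trans (sym (ℕP.+-suc k i)) e)
    rearrange₁ : ∀ k i a b → k * (a + b) + i * a ≡ (k + i) * a + k * b
    rearrange₁ = ℕSolver.solve-∀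
    rearrange₂ : ∀ N r k a b → (N + r) * a + k * b ≡ N * a + (r * a + k * b)
    rearrange₂ = ℕSolver.solve-∀
    rearrange₃ : ∀ i r k a b →
      suc i * b + i * a + (r * a + k * b) ≡ (k + suc i) * b + r * a + i * a
    rearrange₃ = ℕSolver.solve-∀

  -- Here k - r = (N + 1) - (j - 1), which is the factor absorbed when the upper index drops from N
  -- + 1 to N.
  C⁻-split : ∀ N j k {r n} → suc (suc N) + r ≡ n → k + j ≡ n →
             k * (suc N C⁻ j) ≡ r * (suc N C⁻ j) + suc N * (N C⁻ j)
  C⁻-split N zero k {r} refl e = begin
    k * 0              ≡⟨ ℕP.*-zeroʳ k ⟩
    0                  ≡⟨ cong₂ _+_ (ℕP.*-zeroʳ r) (ℕP.*-zeroʳ (suc N)) ⟨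
    r * 0 + suc N * 0  ∎
  C⁻-split N (suc i) k {r} refl e = ℕP.+-cancelʳ-≡ (i * a) _ _ (begin
    k * a + i * a                              ≡⟨ ℕP.*-distribʳ-+ a k i ⟨
    (k + i) * a                                ≡⟨ cong (_* a) k+i≡ ⟩
    (suc N + r) * a                            ≡⟨ ℕP.*-distribʳ-+ a (suc N) r ⟩
    suc N * a + r * a                          ≡⟨ cong (_+ r * a) (descent (suc N) i) ⟨
    suc i * (suc N C suc i) + i * a + r * a    ≡⟨ cong (λ c → c + i * a + r * a) (absorption N i) ⟩
    suc N * (N C i) + i * a + r * a            ≡⟨ rearrange (suc N * (N C i)) (i * a) (r * a) ⟩
    r * a + suc N * (N C i) + i * a            ∎)
    where
    a = suc N C i
    k+i≡ : k + i ≡ suc N + r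
    k+i≡ = ℕP.suc-injective (trans (sym (ℕP.+-suc k i)) e)
    rearrange : ∀ u v w → u + v + w ≡ w + u + v
    rearrange = ℕSolver.solve-∀

  -- Sums weighted by C(p,r) C(q,r), and the telescoping argument.

  open FiniteSums ℕP.+-0-commutativeMonoid
  open import Algebra.Properties.Semiring.Sum ℕP.+-*-semiring using (*-distribˡ-sum)

  pairing : ℕ → ℕ → (ℕ → ℕ) → ℕ
  pairing p q f = ∑[ r ≤ p ] ((p C toℕ r) * (q C toℕ r) * f (toℕ r))

  pairing-cong : ∀ p q {f g : ℕ → ℕ} → (∀ r → r ≤ p → f r ≡ g r) → pairing p q f ≡ pairing p q g
  pairing-cong p q f≡g =
    ∑-cong (suc p) λ { r (s≤s r≤p) → cong ((p C r) * (q C r) *_) (f≡g r r≤p) }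

  pairing-+ : ∀ p q (f g : ℕ → ℕ) → pairing p q (λ r → f r + g r) ≡ pairing p q f + pairing p q g
  pairing-+ p q f g = trans
    (∑-cong (suc p) λ r _ → ℕP.*-distribˡ-+ ((p C r) * (q C r)) (f r) (g r))
    (∑-distrib-+ {suc p} (λ r → (p C toℕ r) * (q C toℕ r) * f (toℕ r))
                         (λ r → (p C toℕ r) * (q C toℕ r) * g (toℕ r)))

  pairing-* : ∀ p q m (f : ℕ → ℕ) → pairing p q (λ r → m * f r) ≡ m * pairing p q f
  pairing-* p q m f = trans
    (∑-cong (suc p) λ r _ → swap ((p C r) * (q C r)) m (f r))
    (sym (*-distribˡ-sum m (λ r → (p C toℕ {suc p} r) * (q C toℕ r) * f (toℕ r))))
    where
    swap : ∀ a b c → a * (b * c) ≡ b * (a * c)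
    swap = ℕSolver.solve-∀

  -- Comparing coefficients of d(r+1), this is (r+1)(C(p+1,r+1) C(q+1,r+1) - C(p,r+1) C(q,r+1)) =
  -- (p+q+1-r) C(p,r) C(q,r). By Pascal's rule and the ratios in `descent`, the left side is C(p,r)
  -- C(q,r) times (r+1) + (p-r) + (q-r).
  pairing-telescope : ∀ p q (d : ℕ → ℕ) →
    pairing (suc p) (suc q) (λ r → r * d r) ≡
    pairing p q (λ r → r * d r + (suc (p + q) ∸ r) * d (suc r))
  pairing-telescope p q d = begin
    pairing (suc p) (suc q) (λ r → r * d r)
      ≡⟨ cong (_+ tail) (ℕP.*-zeroʳ ((suc p C 0) * (suc q C 0))) ⟩
    tail
      ≡⟨ ∑-cong (suc p) (λ { r (s≤s r≤p) → term r r≤p }) ⟩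
    ∑[ r ≤ p ] (u (toℕ r) + v (suc (toℕ r)))
      ≡⟨ ∑-distrib-+ {suc p} (λ r → u (toℕ r)) (λ r → v (suc (toℕ r))) ⟩
    ∑[ r ≤ p ] u (toℕ r) + ∑[ r ≤ p ] v (suc (toℕ r))
      ≡⟨ cong (∑[ r ≤ p ] u (toℕ r) +_) shifted ⟨
    ∑[ r ≤ p ] u (toℕ r) + pairing p q (λ r → r * d r)
      ≡⟨ ℕP.+-comm (∑[ r ≤ p ] u (toℕ r)) _ ⟩
    pairing p q (λ r → r * d r) + pairing p q (λ r → (suc (p + q) ∸ r) * d (suc r))
      ≡⟨ pairing-+ p q (λ r → r * d r) (λ r → (suc (p + q) ∸ r) * d (suc r)) ⟨
    pairing p q (λ r → r * d r + (suc (p + q) ∸ r) * d (suc r)) ∎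
    where
    u v : ℕ → ℕ
    u r = (p C r) * (q C r) * ((suc (p + q) ∸ r) * d (suc r))
    v r = (p C r) * (q C r) * (r * d r)
    tail : ℕ
    tail = ∑[ r ≤ p ] ((suc p C suc (toℕ r)) * (suc q C suc (toℕ r)) *
                       (suc (toℕ r) * d (suc (toℕ r))))
    shifted : pairing p q (λ r → r * d r) ≡ ∑[ r ≤ p ] v (suc (toℕ r))
    shifted = trans
      (∑-shift p v (cong (λ c → c * (q C suc p) * (suc p * d (suc p)))
                         (k>n⇒nCk≡0 (ℕP.n<1+n p))))
      (cong (_+ ∑[ r ≤ p ] v (suc (toℕ r))) (ℕP.*-zeroʳ ((p C 0) * (q C 0))))
    identity : ∀ r s a a′ b b′ D → s + r ≡ suc (p + q) →
      suc r * a′ + r * a ≡ p * a → suc r * b′ + r * b ≡ q * b →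
      (a + a′) * (b + b′) * (suc r * D) ≡ a * b * (s * D) + a′ * b′ * (suc r * D)
    -- The hypotheses encode (p-r)a and (q-r)b with r a and r b on the other side; the added 2rabD
    -- supplies one such term for each.
    identity r s a a′ b b′ D eₛ eₐ e_b = ℕP.+-cancelʳ-≡ (2 * (r * a * b * D)) _ _ (begin
      (a + a′) * (b + b′) * (suc r * D) + 2 * (r * a * b * D)
        ≡⟨ rearrange₁ r a a′ b b′ D ⟩
      ((suc r * a′ + r * a) * b + (suc r * b′ + r * b) * a + suc r * (a * b)) * D
        + a′ * b′ * (suc r * D)
        ≡⟨ cong₂ (λ x y → (x * b + y * a + suc r * (a * b)) * D + a′ * b′ * (suc r * D)) eₐ e_b ⟩
      (p * a * b + q * b * a + suc r * (a * b)) * D + a′ * b′ * (suc r * D)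
        ≡⟨ rearrange₂ p q r a b D (a′ * b′ * (suc r * D)) ⟩
      (suc (p + q) + r) * (a * b * D) + a′ * b′ * (suc r * D)
        ≡⟨ cong (λ m → (m + r) * (a * b * D) + a′ * b′ * (suc r * D)) eₛ ⟨
      (s + r + r) * (a * b * D) + a′ * b′ * (suc r * D)
        ≡⟨ rearrange₃ s r a b D (a′ * b′ * (suc r * D)) ⟩
      a * b * (s * D) + a′ * b′ * (suc r * D) + 2 * (r * a * b * D) ∎)
      where
      rearrange₁ : ∀ r a a′ b b′ D →
        (a + a′) * (b + b′) * (suc r * D) + 2 * (r * a * b * D) ≡
        ((suc r * a′ + r * a) * b + (suc r * b′ + r * b) * a + suc r * (a * b)) * D
          + a′ * b′ * (suc r * D)
      rearrange₁ = ℕSolver.solve-∀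
      rearrange₂ : ∀ p q r a b D z →
        (p * a * b + q * b * a + suc r * (a * b)) * D + z ≡ (suc (p + q) + r) * (a * b * D) + z
      rearrange₂ = ℕSolver.solve-∀
      rearrange₃ : ∀ s r a b D z →
        (s + r + r) * (a * b * D) + z ≡ a * b * (s * D) + z + 2 * (r * a * b * D)
      rearrange₃ = ℕSolver.solve-∀
    term : ∀ r → r ≤ p →
      (suc p C suc r) * (suc q C suc r) * (suc r * d (suc r)) ≡ u r + v (suc r)
    term r r≤p = begin
      (suc p C suc r) * (suc q C suc r) * (suc r * d (suc r))
        ≡⟨ cong₂ (λ x y → x * y * (suc r * d (suc r))) (pascal p r) (pascal q r) ⟩
      (p C r + p C suc r) * (q C r + q C suc r) * (suc r * d (suc r))
        ≡⟨ identity r (suc (p + q) ∸ r) (p C r) (p C suc r) (q C r) (q C suc r) (d (suc r))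
             (ℕP.m∸n+n≡m (ℕP.≤-trans r≤p (ℕP.m≤n⇒m≤1+n (ℕP.m≤m+n p q))))
             (descent p r) (descent q r) ⟩
      u r + v (suc r) ∎

  -- `C-split` gives k C(n-r,j) = n C(n-1-r,j) + r d(r) with d(r) = C(n-1-r,j-1).
  -- `pairing-telescope` carries the r d(r) part from the weights of (p+1,q+1) to those of (p,q),
  -- where `split⁻` collapses the resulting bracket to k d(r).
  pairing-C : ∀ p q j k → k + j ≡ suc (suc (p + q)) →
    k * pairing (suc p) (suc q) (λ r → (suc (suc (p + q)) ∸ r) C j) ≡
    suc (suc (p + q)) * pairing (suc p) (suc q) (λ r → (suc (p + q) ∸ r) C j)
      + k * pairing p q (λ r → (suc (p + q) ∸ r) C⁻ j)
  pairing-C p q j k k+j≡n = begin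
    k * pairing (suc p) (suc q) (λ r → (n ∸ r) C j)
      ≡⟨ pairing-* (suc p) (suc q) k (λ r → (n ∸ r) C j) ⟨
    pairing (suc p) (suc q) (λ r → k * ((n ∸ r) C j))
      ≡⟨ pairing-cong (suc p) (suc q) (λ r r≤ → split r (ℕP.≤-trans r≤ (s≤s (ℕP.m≤m+n p q)))) ⟩
    pairing (suc p) (suc q) (λ r → n * ((suc (p + q) ∸ r) C j) + r * d r)
      ≡⟨ pairing-+ (suc p) (suc q) (λ r → n * ((suc (p + q) ∸ r) C j)) (λ r → r * d r) ⟩
    pairing (suc p) (suc q) (λ r → n * ((suc (p + q) ∸ r) C j))
      + pairing (suc p) (suc q) (λ r → r * d r)
      ≡⟨ cong₂ _+_ (pairing-* (suc p) (suc q) n (λ r → (suc (p + q) ∸ r) C j)) rest ⟩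
    n * pairing (suc p) (suc q) (λ r → (suc (p + q) ∸ r) C j) + k * pairing p q d ∎
    where
    n : ℕ
    n = suc (suc (p + q))
    d : ℕ → ℕ
    d r = (suc (p + q) ∸ r) C⁻ j
    split : ∀ r → r ≤ suc (p + q) →
      k * ((n ∸ r) C j) ≡ n * ((suc (p + q) ∸ r) C j) + r * d r
    split r r≤ = trans (cong (λ m → k * (m C j)) (ℕP.+-∸-assoc 1 r≤))
      (C-split (suc (p + q) ∸ r) j k (cong suc (ℕP.m∸n+n≡m r≤)) k+j≡n)
    split⁻ : ∀ r → r ≤ p + q → k * d r ≡ r * d r + (suc (p + q) ∸ r) * d (suc r)
    split⁻ r r≤ rewrite ℕP.+-∸-assoc 1 r≤ =
      C⁻-split (p + q ∸ r) j k (cong (λ m → suc (suc m)) (ℕP.m∸n+n≡m r≤)) k+j≡n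
    rest : pairing (suc p) (suc q) (λ r → r * d r) ≡ k * pairing p q d
    rest = begin
      pairing (suc p) (suc q) (λ r → r * d r)
        ≡⟨ pairing-telescope p q d ⟩
      pairing p q (λ r → r * d r + (suc (p + q) ∸ r) * d (suc r))
        ≡⟨ pairing-cong p q (λ r r≤p → split⁻ r (ℕP.≤-trans r≤p (ℕP.m≤m+n p q))) ⟨
      pairing p q (λ r → k * d r)
        ≡⟨ pairing-* p q k d ⟩
      k * pairing p q d ∎

  -- Coefficients of y^(p+q-j) in G(p,q) and in Y G(p-1,q-1).
  coeff⁺ coeff⁻ : ℕ → ℕ → ℕ → ℕ
  coeff⁺ p q j = pairing p q (λ r → (p + q ∸ r) C j)
  coeff⁻ zero    q       j = 0
  coeff⁻ (suc p) zero    j = 0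
  coeff⁻ (suc p) (suc q) j = pairing p q (λ r → (p + suc q ∸ r) C⁻ j)

  pairing-const : ∀ p q (f : ℕ → ℕ) → (∀ r → f (suc r) ≡ 0) → pairing p q f ≡ f 0
  pairing-const p q f f≡0 = begin
    pairing p q f
      ≡⟨ cong (1 * f 0 +_) (∑-zero p λ r →
           trans (cong ((p C suc r) * (q C suc r) *_) (f≡0 r)) (ℕP.*-zeroʳ ((p C suc r) * (q C suc r)))) ⟩
    1 * f 0 + 0
      ≡⟨ trans (ℕP.+-identityʳ _) (ℕP.+-identityʳ _) ⟩
    f 0 ∎

  pairing-zeroʳ : ∀ p (f : ℕ → ℕ) → pairing p 0 f ≡ f 0
  pairing-zeroʳ p f = begin
    pairing p 0 f
      ≡⟨ cong (1 * f 0 +_) (∑-zero p λ r → cong (_* f (suc r)) (ℕP.*-zeroʳ (p C suc r))) ⟩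
    1 * f 0 + 0
      ≡⟨ trans (ℕP.+-identityʳ _) (ℕP.+-identityʳ _) ⟩
    f 0 ∎

  pairing-zeroˡ : ∀ q (f : ℕ → ℕ) → pairing 0 q f ≡ f 0
  pairing-zeroˡ q f = trans (ℕP.+-identityʳ _) (ℕP.+-identityʳ _)

  +*-zeroʳ : ∀ a k → a + k * 0 ≡ a
  +*-zeroʳ = ℕSolver.solve-∀

  -- When p or q is 0 only r = 0 contributes and the claim is absorption; the remaining case is
  -- `pairing-C`.
  coeff-pairing : ∀ p q k j {m} → p + q ≡ suc m → suc k + j ≡ suc m →
    suc k * coeff⁺ p q j ≡
    suc m * pairing p q (λ r → (m ∸ r) C j) + suc k * coeff⁻ p q j
  coeff-pairing zero    q       k j {m} refl e = begin
    suc k * coeff⁺ 0 (suc m) j       ≡⟨ cong (suc k *_) (pairing-zeroˡ q (λ r → (suc m ∸ r) C j)) ⟩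
    suc k * (suc m C j)              ≡⟨ cong (suc k *_) (C-sym (suc k) j e) ⟨
    suc k * (suc m C suc k)          ≡⟨ absorption-reflected m k j e ⟩
    suc m * (m C j)                  ≡⟨ cong (suc m *_) (pairing-zeroˡ q (λ r → (m ∸ r) C j)) ⟨
    suc m * pairing 0 q (λ r → (m ∸ r) C j)  ≡⟨ +*-zeroʳ (suc m * pairing 0 q (λ r → (m ∸ r) C j)) k ⟨
    suc m * pairing 0 q (λ r → (m ∸ r) C j) + suc k * 0  ∎
  coeff-pairing (suc p) zero    k j {m} p+q≡n e = begin
    suc k * coeff⁺ (suc p) 0 j       ≡⟨ cong (suc k *_) (pairing-zeroʳ (suc p) (λ r → (suc p + 0 ∸ r) C j)) ⟩
    suc k * ((suc p + 0) C j)      ≡⟨ cong (λ n → suc k * (n C j)) p+q≡n ⟩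
    suc k * (suc m C j)              ≡⟨ cong (suc k *_) (C-sym (suc k) j e) ⟨
    suc k * (suc m C suc k)          ≡⟨ absorption-reflected m k j e ⟩
    suc m * (m C j)                  ≡⟨ cong (suc m *_) (pairing-zeroʳ (suc p) (λ r → (m ∸ r) C j)) ⟨
    suc m * pairing (suc p) 0 (λ r → (m ∸ r) C j)  ≡⟨ +*-zeroʳ (suc m * pairing (suc p) 0 (λ r → (m ∸ r) C j)) k ⟨
    suc m * pairing (suc p) 0 (λ r → (m ∸ r) C j) + suc k * 0  ∎
  coeff-pairing (suc p) (suc q) k j refl e rewrite ℕP.+-suc p q = pairing-C p q j (suc k) e

  -- The lower index n corresponds to k = 0, and C(n-r,n) vanishes unless r = 0.
  coeff⁺-0 : ∀ p q {m} → p + q ≡ suc m → coeff⁺ p q (suc m) ≡ 1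
  coeff⁺-0 p q {m} p+q≡n rewrite p+q≡n = trans
    (pairing-const p q (λ r → (suc m ∸ r) C suc m) (λ r → k>n⇒nCk≡0 (s≤s (ℕP.m∸n≤m m r))))
    (nCn≡1 (suc m))

  coeff⁻-0 : ∀ p q {m} → suc p + suc q ≡ suc m → coeff⁻ (suc p) (suc q) (suc m) ≡ 1
  coeff⁻-0 p q refl rewrite ℕP.+-suc p q = trans
    (pairing-const p q (λ r → (suc (p + q) ∸ r) C suc (p + q))
      (λ r → k>n⇒nCk≡0 (s≤s (ℕP.m∸n≤m (p + q) r))))
    (nCn≡1 (suc (p + q)))

-- The hypergeometric sum over ℚ.

module _ where
  open import Data.Rational.Base using (_+_; _*_; -_; _-_; _÷_; 1/_)
  open ≡ using (refl; sym; trans; cong; cong₂; subst)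
  open ≡.≡-Reasoning
  open FiniteSums ℚP.+-0-commutativeMonoid
  open import Algebra.Properties.Semiring.Sum (CommutativeRing.semiring ℚP.+-*-commutativeRing)
    using (*-distribˡ-sum)
  open import Data.Rational.Solver using (module +-*-Solver)
  open +-*-Solver using (solve; _:=_; _:+_; _:*_; _:-_; :-_; con)
  import Algebra.Properties.CommutativeMonoid.Sum ℕP.+-0-commutativeMonoid as ℕΣ

  fromℕ-+ : ∀ m n → fromℕ (m ℕ.+ n) ≡ fromℕ m + fromℕ n
  fromℕ-+ m n = ℚP.toℚᵘ-injective
    (ℚᵘP.≃-trans (ℚP.toℚᵘ-fromℚᵘ (mkℚᵘ (+ (m ℕ.+ n)) 0))
    (ℚᵘP.≃-trans (*≡* (identity (+ m) (+ n)))
    (ℚᵘP.≃-trans (ℚᵘP.+-cong (ℚᵘP.≃-sym (ℚP.toℚᵘ-fromℚᵘ (mkℚᵘ (+ m) 0)))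
                     (ℚᵘP.≃-sym (ℚP.toℚᵘ-fromℚᵘ (mkℚᵘ (+ n) 0))))
             (ℚᵘP.≃-sym (ℚP.toℚᵘ-homo-+ (fromℕ m) (fromℕ n))))))
    where
    open import Data.Rational.Unnormalised.Base using (mkℚᵘ; *≡*)
    import Data.Rational.Unnormalised.Properties as ℚᵘP
    open import Data.Integer.Base as ℤ using (+_)
    import Data.Integer.Tactic.RingSolver as ℤSolver
    identity : ∀ a b → (a ℤ.+ b) ℤ.* + 1 ≡ (a ℤ.* + 1 ℤ.+ b ℤ.* + 1) ℤ.* + 1
    identity = ℤSolver.solve-∀

  fromℕ-suc : ∀ n → fromℕ (suc n) ≡ 1ℚ + fromℕ n
  fromℕ-suc = fromℕ-+ 1

  fromℕ-* : ∀ m n → fromℕ (m ℕ.* n) ≡ fromℕ m * fromℕ n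
  fromℕ-* zero    n = sym (ℚP.*-zeroˡ (fromℕ n))
  fromℕ-* (suc m) n = begin
    fromℕ (n ℕ.+ m ℕ.* n)            ≡⟨ fromℕ-+ n (m ℕ.* n) ⟩
    fromℕ n + fromℕ (m ℕ.* n)        ≡⟨ cong (fromℕ n +_) (fromℕ-* m n) ⟩
    fromℕ n + fromℕ m * fromℕ n      ≡⟨ solve 2 (λ m n → n :+ m :* n := (con 1ℚ :+ m) :* n) refl
                                          (fromℕ m) (fromℕ n) ⟩
    (1ℚ + fromℕ m) * fromℕ n         ≡⟨ cong (_* fromℕ n) (fromℕ-suc m) ⟨
    fromℕ (suc m) * fromℕ n          ∎

  fromℕ-nonZero : ∀ n .⦃ _ : ℕ.NonZero n ⦄ → ℚ.NonZero (fromℕ n)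
  fromℕ-nonZero n = ℚP.pos⇒nonZero (fromℕ n) ⦃ ℚP.normalize-pos n 1 ⦄

  fromℕ-sum : ∀ n (f : ℕ → ℕ) →
    fromℕ (ℕΣ.sum {n} (λ i → f (toℕ i))) ≡ ∑[ i < n ] fromℕ (f (toℕ i))
  fromℕ-sum zero    f = refl
  fromℕ-sum (suc n) f =
    trans (fromℕ-+ (f 0) _) (cong (fromℕ (f 0) +_) (fromℕ-sum n (λ i → f (suc i))))

  *-cancelˡ : ∀ a {b c} .⦃ _ : ℚ.NonZero a ⦄ → a * b ≡ a * c → b ≡ c
  *-cancelˡ a {b} {c} ab≡ac = begin
    b                ≡⟨ unit b ⟨
    (1/ a) * (a * b) ≡⟨ cong ((1/ a) *_) ab≡ac ⟩
    (1/ a) * (a * c) ≡⟨ unit c ⟩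
    c                ∎
    where
    unit : ∀ b → (1/ a) * (a * b) ≡ b
    unit b = trans (sym (ℚP.*-assoc (1/ a) a b))
      (trans (cong (_* b) (ℚP.*-inverseˡ a)) (ℚP.*-identityˡ b))

  *-÷ : ∀ m a b c .⦃ _ : ℚ.NonZero b ⦄ → m * a ≡ c * b → m * (a ÷ b) ≡ c
  *-÷ m a b c ma≡cb = begin
    m * (a * 1/ b)   ≡⟨ ℚP.*-assoc m a (1/ b) ⟨
    m * a * 1/ b     ≡⟨ cong (_* 1/ b) ma≡cb ⟩
    c * b * 1/ b     ≡⟨ ℚP.*-assoc c b (1/ b) ⟩
    c * (b * 1/ b)   ≡⟨ cong (c *_) (ℚP.*-inverseʳ b) ⟩
    c * 1ℚ           ≡⟨ ℚP.*-identityʳ c ⟩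
    c                ∎

  rising-1 : ∀ r → 1ℚ ⟮ r ⟯ ≡ fromℕ (r !)
  rising-1 zero    = refl
  rising-1 (suc r) = begin
    1ℚ ⟮ r ⟯ * (1ℚ + fromℕ r)        ≡⟨ cong₂ _*_ (rising-1 r) (sym (fromℕ-suc r)) ⟩
    fromℕ (r !) * fromℕ (suc r)      ≡⟨ ℚP.*-comm (fromℕ (r !)) (fromℕ (suc r)) ⟩
    fromℕ (suc r) * fromℕ (r !)      ≡⟨ fromℕ-* (suc r) (r !) ⟨
    fromℕ (suc r !)                  ∎

  descentℚ : ∀ p r → fromℕ (suc r) * fromℕ (p C suc r) ≡ (fromℕ p - fromℕ r) * fromℕ (p C r)
  descentℚ p r = begin
    R′ * c′                        ≡⟨ solve 3 (λ a r c → a := (a :+ r :* c) :- r :* c) refl (R′ * c′) R c ⟩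
    (R′ * c′ + R * c) - R * c      ≡⟨ cong (_- R * c) (begin
      R′ * c′ + R * c                ≡⟨ cong₂ _+_ (fromℕ-* (suc r) (p C suc r)) (fromℕ-* r (p C r)) ⟨
      fromℕ (suc r ℕ.* (p C suc r)) + fromℕ (r ℕ.* (p C r))
                                     ≡⟨ fromℕ-+ (suc r ℕ.* (p C suc r)) (r ℕ.* (p C r)) ⟨
      fromℕ (suc r ℕ.* (p C suc r) ℕ.+ r ℕ.* (p C r))
                                     ≡⟨ cong fromℕ (descent p r) ⟩
      fromℕ (p ℕ.* (p C r))          ≡⟨ fromℕ-* p (p C r) ⟩
      P * c                          ∎) ⟩
    P * c - R * c                  ≡⟨ solve 3 (λ p r c → p :* c :- r :* c := (p :- r) :* c) refl P R c ⟩
    (P - R) * c                    ∎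
    where
    P R R′ c c′ : ℚ
    P = fromℕ p
    R = fromℕ r
    R′ = fromℕ (suc r)
    c = fromℕ (p C r)
    c′ = fromℕ (p C suc r)

  weight : ℕ → ℕ → ℕ → ℚ
  weight p q r = fromℕ (p C r) * fromℕ (q C r)

  -- (-p)_r (-q)_r = C(p,r) C(q,r) r! r!; the signs of the two factors cancel.
  rising-neg : ∀ p q r → (- fromℕ p) ⟮ r ⟯ * (- fromℕ q) ⟮ r ⟯ ≡
                         weight p q r * (fromℕ (r !) * fromℕ (r !))
  rising-neg p q zero    = refl
  rising-neg p q (suc r) = begin
    A * (- P + R) * (B * (- Q + R))
      ≡⟨ solve 5 (λ a b p q r → a :* (:- p :+ r) :* (b :* (:- q :+ r)) :=
                                a :* b :* ((p :- r) :* (q :- r))) refl A B P Q R ⟩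
    A * B * ((P - R) * (Q - R))
      ≡⟨ cong (_* ((P - R) * (Q - R))) (rising-neg p q r) ⟩
    fromℕ (p C r) * fromℕ (q C r) * (F * F) * ((P - R) * (Q - R))
      ≡⟨ solve 5 (λ c d f u v → c :* d :* (f :* f) :* (u :* v) :=
                                (u :* c) :* (v :* d) :* (f :* f)) refl
           (fromℕ (p C r)) (fromℕ (q C r)) F (P - R) (Q - R) ⟩
    (P - R) * fromℕ (p C r) * ((Q - R) * fromℕ (q C r)) * (F * F)
      ≡⟨ cong₂ (λ u v → u * v * (F * F)) (descentℚ p r) (descentℚ q r) ⟨
    R′ * fromℕ (p C suc r) * (R′ * fromℕ (q C suc r)) * (F * F)
      ≡⟨ solve 4 (λ c d f r → r :* c :* (r :* d) :* (f :* f) :=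
                              c :* d :* (r :* f :* (r :* f))) refl
           (fromℕ (p C suc r)) (fromℕ (q C suc r)) F R′ ⟩
    weight p q (suc r) * (R′ * F * (R′ * F))
      ≡⟨ cong (λ f → weight p q (suc r) * (f * f)) (fromℕ-* (suc r) (r !)) ⟨
    weight p q (suc r) * (fromℕ (suc r !) * fromℕ (suc r !)) ∎
    where
    A B P Q R R′ F : ℚ
    A = (- fromℕ p) ⟮ r ⟯
    B = (- fromℕ q) ⟮ r ⟯
    P = fromℕ p
    Q = fromℕ q
    R = fromℕ r
    R′ = fromℕ (suc r)
    F = fromℕ (r !)

  -- Besides (1-n)_r the denominator is (1)_r r! = r!², exactly the square that `rising-neg`
  -- extracts from the numerator. Leaving the scale `m` and the ratio `c` free lets one lemma serve
  -- both k > 0 and k = 0.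
  term-scaled : ∀ n p q k r m c → p ℕ.+ q ≡ n →
    m * (1ℚ - fromℕ k) ⟮ r ⟯ ≡ c * (1ℚ - fromℕ n) ⟮ r ⟯ →
    m * numerator n p k r ≡ weight p q r * c * denominator n r
  term-scaled n p q k r m c refl mK≡cN = begin
    m * (K * A * (P - fromℕ n) ⟮ r ⟯)
      ≡⟨ cong (λ x → m * (K * A * x ⟮ r ⟯)) (trans
           (cong (λ x → P - x) (fromℕ-+ p q))
           (solve 2 (λ p q → p :- (p :+ q) := :- q) refl P (fromℕ q))) ⟩
    m * (K * A * B)
      ≡⟨ solve 4 (λ m k a b → m :* (k :* a :* b) := (m :* k) :* (a :* b)) refl m K A B ⟩
    (m * K) * (A * B)
      ≡⟨ cong₂ _*_ mK≡cN (rising-neg p q r) ⟩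
    (c * N) * (W * (F * F))
      ≡⟨ solve 4 (λ c n w f → (c :* n) :* (w :* (f :* f)) := w :* c :* (n :* f :* f)) refl c N W F ⟩
    W * c * (N * F * F)
      ≡⟨ cong (λ f → W * c * (N * f * F)) (rising-1 r) ⟨
    W * c * denominator n r ∎
    where
    P K A B N W F : ℚ
    P = fromℕ p
    K = (1ℚ - fromℕ k) ⟮ r ⟯
    A = (- P) ⟮ r ⟯
    B = (- fromℕ q) ⟮ r ⟯
    N = (1ℚ - fromℕ n) ⟮ r ⟯
    W = weight p q r
    F = fromℕ (r !)

  -- Repeats the sum inside `binomial` verbatim, so that `binomial n p k` is
  -- `fromℕ (n C k) * hypergeometric n p k` by definition.
  hypergeometric : (n p k : ℕ) → ℚ
  hypergeometric n p k = ∑[ r ≤ p ⊓ (n ∸ p) ]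
    (_÷_ (numerator n p k (toℕ r)) (denominator n (toℕ r))
      ⦃ denominator-nonZero n p (toℕ r) (toℕ≤pred[n] r) ⦄)

  weight-zero : ∀ p q r → p ⊓ q ℕ.< r → weight p q r ≡ 0ℚ
  weight-zero p q r p⊓q<r with r ℕP.≤? p | r ℕP.≤? q
  ... | no r≰p  | _       = trans (cong (λ c → fromℕ c * fromℕ (q C r)) (k>n⇒nCk≡0 (ℕP.≰⇒> r≰p)))
                                  (ℚP.*-zeroˡ (fromℕ (q C r)))
  ... | yes _   | no r≰q  = trans (cong (λ c → fromℕ (p C r) * fromℕ c) (k>n⇒nCk≡0 (ℕP.≰⇒> r≰q)))
                                  (ℚP.*-zeroʳ (fromℕ (p C r)))
  ... | yes r≤p | yes r≤q = contradiction (ℕP.⊓-glb r≤p r≤q) (ℕP.<⇒≱ p⊓q<r)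

  -- Beyond min(p,q) the weight is 0, so the sum can be lengthened to r ≤ p, the range of `pairing`,
  -- while the ratio is required only up to min(p,q).
  hypergeometric-scaled : ∀ n p q k m (c : ℕ → ℚ) → p ℕ.+ q ≡ n →
    (∀ r → r ≤ p → r ≤ q → m * (1ℚ - fromℕ k) ⟮ r ⟯ ≡ c r * (1ℚ - fromℕ n) ⟮ r ⟯) →
    m * hypergeometric n p k ≡ ∑[ r ≤ p ] (weight p q (toℕ r) * c (toℕ r))
  hypergeometric-scaled n p q k m c p+q≡n ratio = begin
    m * sum {suc b} t
      ≡⟨ *-distribˡ-sum {suc b} m t ⟩
    sum {suc b} (λ r → m * t r)
      ≡⟨ sum-cong-≗ {suc b} t-scaled ⟩
    ∑[ r ≤ b ] u (toℕ r)
      ≡⟨ ∑-truncate u (s≤s (ℕP.m⊓n≤m p (n ∸ p))) (λ r b<r → trans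
           (cong (_* c r) (weight-zero p q r (subst (λ z → p ⊓ z ℕ.< r) n∸p≡q b<r)))
           (ℚP.*-zeroˡ (c r))) ⟨
    ∑[ r ≤ p ] u (toℕ r) ∎
    where
    b : ℕ
    b = p ⊓ (n ∸ p)
    n∸p≡q : n ∸ p ≡ q
    n∸p≡q = trans (cong (_∸ p) (sym p+q≡n)) (ℕP.m+n∸m≡n p q)
    t : Fin (suc b) → ℚ
    t r = _÷_ (numerator n p k (toℕ r)) (denominator n (toℕ r))
            ⦃ denominator-nonZero n p (toℕ r) (toℕ≤pred[n] r) ⦄
    u : ℕ → ℚ
    u r = weight p q r * c r
    t-scaled : ∀ r → m * t r ≡ u (toℕ r)
    t-scaled r = *-÷ m (numerator n p k (toℕ r)) (denominator n (toℕ r)) (u (toℕ r))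
      ⦃ denominator-nonZero n p (toℕ r) (toℕ≤pred[n] r) ⦄
      (term-scaled n p q k (toℕ r) m (c (toℕ r)) p+q≡n
        (ratio (toℕ r) (ℕP.m≤n⊓o⇒m≤n p (n ∸ p) (toℕ≤pred[n] r))
          (subst (toℕ r ≤_) n∸p≡q (ℕP.m≤n⊓o⇒m≤o p (n ∸ p) (toℕ≤pred[n] r)))))

  ∸-suc : ∀ {m r} → suc r ≤ m → m ∸ r ≡ suc (m ∸ suc r)
  ∸-suc r<m = ℕP.+-∸-assoc 1 r<m

  fromℕ-∸ : ∀ {m r} → r ≤ m → fromℕ m ≡ fromℕ r + fromℕ (m ∸ r)
  fromℕ-∸ {m} {r} r≤m = trans (cong fromℕ (sym (ℕP.m+[n∸m]≡n r≤m))) (fromℕ-+ r (m ∸ r))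

  -- The coefficients for k > 0.

  -- Passing from r to r + 1 multiplies the left side by r - k = j - (m-r) and the rising factorial
  -- on the right by -(m-r); `absorption-complement` matches the two as (m-r-j) C(m-r,j) = (m-r)
  -- C(m-r-1,j). For r > k both sides are 0.
  rising-ratio : ∀ m k j → suc k ℕ.+ j ≡ suc m → ∀ r → r ≤ m →
    fromℕ (suc k ℕ.* (suc m C suc k)) * (1ℚ - fromℕ (suc k)) ⟮ r ⟯ ≡
    fromℕ (suc m ℕ.* ((m ∸ r) C j)) * (1ℚ - fromℕ (suc m)) ⟮ r ⟯
  rising-ratio m k j e zero    r≤m = cong (λ z → fromℕ z * 1ℚ) (absorption-reflected m k j e)
  rising-ratio m k j e (suc r) r<m = begin
    X * (A * (1ℚ - K + R))
      ≡⟨ ℚP.*-assoc X A (1ℚ - K + R) ⟨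
    X * A * (1ℚ - K + R)
      ≡⟨ cong₂ _*_ (rising-ratio m k j e r (ℕP.<⇒≤ r<m)) 1-K+R ⟩
    fromℕ (suc m ℕ.* ((m ∸ r) C j)) * B * (J - N)
      ≡⟨ cong (λ z → z * B * (J - N)) (trans
           (cong (λ z → fromℕ (suc m ℕ.* (z C j))) m∸r≡) (fromℕ-* (suc m) (suc N′ C j))) ⟩
    M * c * B * (J - N)
      ≡⟨ solve 5 (λ m c b j n → m :* c :* b :* (j :- n) := m :* b :* (j :* c :- n :* c)) refl M c B J N ⟩
    M * B * (J * c - N * c)
      ≡⟨ cong (λ z → M * B * (J * c - z)) N*c ⟩
    M * B * (J * c - (J * c + N * c′))
      ≡⟨ solve 6 (λ m c b j n d → m :* b :* (j :* c :- (j :* c :+ n :* d)) := m :* d :* (b :* :- n)) refl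
           M c B J N c′ ⟩
    M * c′ * (B * - N)
      ≡⟨ cong₂ (λ u v → u * (B * v)) (fromℕ-* (suc m) (N′ C j)) 1-M+R ⟨
    fromℕ (suc m ℕ.* (N′ C j)) * (B * (1ℚ - M + R)) ∎
    where
    N′ : ℕ
    N′ = m ∸ suc r
    X A B K M R J N c c′ : ℚ
    X = fromℕ (suc k ℕ.* (suc m C suc k))
    A = (1ℚ - fromℕ (suc k)) ⟮ r ⟯
    B = (1ℚ - fromℕ (suc m)) ⟮ r ⟯
    K = fromℕ (suc k)
    M = fromℕ (suc m)
    R = fromℕ r
    J = fromℕ j
    N = fromℕ (suc N′)
    c = fromℕ (suc N′ C j)
    c′ = fromℕ (N′ C j)
    m∸r≡ : m ∸ r ≡ suc N′
    m∸r≡ = ∸-suc r<m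
    M≡ : M ≡ 1ℚ + (R + N)
    M≡ = trans (fromℕ-suc m) (cong (1ℚ +_) (trans (fromℕ-∸ (ℕP.<⇒≤ r<m)) (cong (λ z → R + fromℕ z) m∸r≡)))
    1-M+R : 1ℚ - M + R ≡ - N
    1-M+R = trans (cong (λ z → 1ℚ - z + R) M≡)
      (solve 2 (λ r n → con 1ℚ :- (con 1ℚ :+ (r :+ n)) :+ r := :- n) refl R N)
    1-K+R : 1ℚ - K + R ≡ J - N
    1-K+R = begin
      1ℚ - K + R              ≡⟨ solve 3 (λ k r j → con 1ℚ :- k :+ r := j :+ (con 1ℚ :- (k :+ j) :+ r)) refl K R J ⟩
      J + (1ℚ - (K + J) + R)  ≡⟨ cong (λ z → J + (1ℚ - z + R)) (trans (sym (fromℕ-+ (suc k) j)) (cong fromℕ e)) ⟩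
      J + (1ℚ - M + R)        ≡⟨ cong (J +_) 1-M+R ⟩
      J - N                   ∎
    N*c : N * c ≡ J * c + N * c′
    N*c = begin
      N * c
        ≡⟨ fromℕ-* (suc N′) (suc N′ C j) ⟨
      fromℕ (suc N′ ℕ.* (suc N′ C j))
        ≡⟨ cong fromℕ (absorption-complement N′ j) ⟩
      fromℕ (j ℕ.* (suc N′ C j) ℕ.+ suc N′ ℕ.* (N′ C j))
        ≡⟨ fromℕ-+ (j ℕ.* (suc N′ C j)) (suc N′ ℕ.* (N′ C j)) ⟩
      fromℕ (j ℕ.* (suc N′ C j)) + fromℕ (suc N′ ℕ.* (N′ C j))
        ≡⟨ cong₂ _+_ (fromℕ-* j (suc N′ C j)) (fromℕ-* (suc N′) (N′ C j)) ⟩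
      J * c + N * c′ ∎

  -- For r ≥ 1, r + 1 ≤ 2r ≤ p + q. The bound guards `m ∸ r` against truncation.
  common-bound : ∀ {p q m r} → p ℕ.+ q ≡ suc m → r ≤ p → r ≤ q → r ≤ m
  common-bound {r = zero}  e r≤p r≤q = z≤n
  common-bound {r = suc r} e r≤p r≤q = ℕ.s≤s⁻¹ (ℕP.≤-trans
    (ℕP.≤-trans (s≤s (ℕP.m≤n+m (suc r) r)) (ℕP.+-mono-≤ r≤p r≤q)) (ℕP.≤-reflexive e))

  -- After multiplication by k + 1 every quantity is the image of a natural number, and
  -- `rising-ratio` and `coeff-pairing` meet at n Σ C(p,r) C(q,r) C(n-1-r,j).
  binomial-suc : ∀ p q k j {m} → p ℕ.+ q ≡ suc m → suc k ℕ.+ j ≡ suc m →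
    binomial (suc m) p (suc k) + fromℕ (coeff⁻ p q j) ≡ fromℕ (coeff⁺ p q j)
  binomial-suc p q k j {m} p+q≡n e = *-cancelˡ (fromℕ (suc k)) ⦃ fromℕ-nonZero (suc k) ⦄ (begin
    K * (binomial n p (suc k) + c⁻)
      ≡⟨ solve 4 (λ k c s d → k :* (c :* s :+ d) := k :* c :* s :+ k :* d) refl
           K (fromℕ (n C suc k)) (hypergeometric n p (suc k)) c⁻ ⟩
    K * fromℕ (n C suc k) * hypergeometric n p (suc k) + K * c⁻
      ≡⟨ cong (λ z → z * hypergeometric n p (suc k) + K * c⁻) (fromℕ-* (suc k) (n C suc k)) ⟨
    fromℕ (suc k ℕ.* (n C suc k)) * hypergeometric n p (suc k) + K * c⁻
      ≡⟨ cong (_+ K * c⁻) (hypergeometric-scaled n p q (suc k) (fromℕ (suc k ℕ.* (n C suc k)))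
           (λ r → fromℕ (n ℕ.* d r)) p+q≡n
           (λ r r≤p r≤q → rising-ratio m k j e r (common-bound p+q≡n r≤p r≤q))) ⟩
    ∑[ r ≤ p ] (weight p q (toℕ r) * fromℕ (n ℕ.* d (toℕ r))) + K * c⁻
      ≡⟨ cong (_+ K * c⁻) (trans
           (∑-cong (suc p) (λ r _ → sym (trans
             (fromℕ-* ((p C r) ℕ.* (q C r)) (n ℕ.* d r))
             (cong (_* fromℕ (n ℕ.* d r)) (fromℕ-* (p C r) (q C r))))))
           (sym (fromℕ-sum (suc p) (λ r → (p C r) ℕ.* (q C r) ℕ.* (n ℕ.* d r))))) ⟩
    fromℕ (pairing p q (λ r → n ℕ.* d r)) + K * c⁻
      ≡⟨ cong₂ _+_ (cong fromℕ (pairing-* p q n d)) (sym (fromℕ-* (suc k) (coeff⁻ p q j))) ⟩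
    fromℕ (n ℕ.* pairing p q d) + fromℕ (suc k ℕ.* coeff⁻ p q j)
      ≡⟨ fromℕ-+ (n ℕ.* pairing p q d) (suc k ℕ.* coeff⁻ p q j) ⟨
    fromℕ (n ℕ.* pairing p q d ℕ.+ suc k ℕ.* coeff⁻ p q j)
      ≡⟨ cong fromℕ (coeff-pairing p q k j p+q≡n e) ⟨
    fromℕ (suc k ℕ.* coeff⁺ p q j)
      ≡⟨ fromℕ-* (suc k) (coeff⁺ p q j) ⟩
    K * fromℕ (coeff⁺ p q j) ∎)
    where
    n : ℕ
    n = suc m
    d : ℕ → ℕ
    d r = (m ∸ r) C j
    K c⁻ : ℚ
    K = fromℕ (suc k)
    c⁻ = fromℕ (coeff⁻ p q j)

  -- The coefficients for k = 0.

  sign : ℕ → ℚ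
  sign zero    = 1ℚ
  sign (suc r) = - sign r

  -- For r ≤ m this is m! (1)_r / (-m)_r. With m = n - 1 it is m! times the ratio (1-k)_r / (1-n)_r
  -- at k = 0.
  alternating : ℕ → ℕ → ℚ
  alternating m r = sign r * (fromℕ (r !) * fromℕ ((m ∸ r) !))

  alternating-suc : ∀ {m r} → suc r ≤ m →
    fromℕ (m ∸ r) * alternating m (suc r) ≡ - (fromℕ (suc r) * alternating m r)
  alternating-suc {m} {r} r<m = begin
    fromℕ (m ∸ r) * (- sign r * (fromℕ (suc r !) * fromℕ (N !)))
      ≡⟨ cong₂ (λ z u → fromℕ z * (- sign r * (u * fromℕ (N !)))) (∸-suc r<m) (fromℕ-* (suc r) (r !)) ⟩
    fromℕ (suc N) * (- sign r * (fromℕ (suc r) * fromℕ (r !) * fromℕ (N !)))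
      ≡⟨ solve 5 (λ n s r f g → n :* (:- s :* (r :* f :* g)) := :- (r :* (s :* (f :* (n :* g))))) refl
           (fromℕ (suc N)) (sign r) (fromℕ (suc r)) (fromℕ (r !)) (fromℕ (N !)) ⟩
    - (fromℕ (suc r) * (sign r * (fromℕ (r !) * (fromℕ (suc N) * fromℕ (N !)))))
      ≡⟨ cong (λ z → - (fromℕ (suc r) * (sign r * (fromℕ (r !) * z)))) (trans
           (sym (fromℕ-* (suc N) (N !))) (cong (λ z → fromℕ (z !)) (sym (∸-suc r<m)))) ⟩
    - (fromℕ (suc r) * alternating m r) ∎
    where
    N : ℕ
    N = m ∸ suc r

  alternating-ratio : ∀ m r → r ≤ m →
    fromℕ (m !) * (1ℚ - fromℕ 0) ⟮ r ⟯ ≡ alternating m r * (1ℚ - fromℕ (suc m)) ⟮ r ⟯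
  alternating-ratio m zero    r≤m = solve 1 (λ f → f :* con 1ℚ := con 1ℚ :* (con 1ℚ :* f) :* con 1ℚ) refl
    (fromℕ (m !))
  alternating-ratio m (suc r) r<m = begin
    F * (1ℚ ⟮ r ⟯ * (1ℚ + R))
      ≡⟨ ℚP.*-assoc F (1ℚ ⟮ r ⟯) (1ℚ + R) ⟨
    F * 1ℚ ⟮ r ⟯ * (1ℚ + R)
      ≡⟨ cong₂ _*_ (alternating-ratio m r (ℕP.<⇒≤ r<m)) (sym (fromℕ-suc r)) ⟩
    alternating m r * B * R′
      ≡⟨ solve 3 (λ a b r → a :* b :* r := :- (:- (r :* a) :* b)) refl (alternating m r) B R′ ⟩
    - (- (R′ * alternating m r) * B)
      ≡⟨ cong (λ z → - (z * B)) (alternating-suc r<m) ⟨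
    - (N * alternating m (suc r) * B)
      ≡⟨ solve 4 (λ n a b r → :- (n :* a :* b) := a :* (b :* (con 1ℚ :- (con 1ℚ :+ (r :+ n)) :+ r))) refl
           N (alternating m (suc r)) B R ⟩
    alternating m (suc r) * (B * (1ℚ - (1ℚ + (R + N)) + R))
      ≡⟨ cong (λ z → alternating m (suc r) * (B * (1ℚ - z + R))) (trans
           (fromℕ-suc m) (cong (1ℚ +_) (fromℕ-∸ (ℕP.<⇒≤ r<m)))) ⟨
    alternating m (suc r) * (B * (1ℚ - fromℕ (suc m) + R)) ∎
    where
    F B R R′ N : ℚ
    F = fromℕ (m !)
    B = (1ℚ - fromℕ (suc m)) ⟮ r ⟯
    R = fromℕ r
    R′ = fromℕ (suc r)
    N = fromℕ (m ∸ r)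

  hypergeometric-0 : ∀ p q {m} → p ℕ.+ q ≡ suc m →
    fromℕ (m !) * hypergeometric (suc m) p 0 ≡ ∑[ r ≤ p ] (weight p q (toℕ r) * alternating m (toℕ r))
  hypergeometric-0 p q {m} p+q≡n = hypergeometric-scaled (suc m) p q 0 (fromℕ (m !)) (alternating m)
    p+q≡n (λ r r≤p r≤q → alternating-ratio m r (common-bound p+q≡n r≤p r≤q))

  hypergeometric-edge : ∀ p q {m} → p ℕ.+ q ≡ suc m → p ⊓ q ≡ 0 → hypergeometric (suc m) p 0 ≡ 1ℚ
  hypergeometric-edge p q {m} p+q≡n p⊓q≡0 = *-cancelˡ F ⦃ fromℕ-nonZero (m !) ⦃ m ℕP.!≢0 ⦄ ⦄ (begin
    F * hypergeometric (suc m) p 0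
      ≡⟨ hypergeometric-0 p q p+q≡n ⟩
    ∑[ r ≤ p ] t (toℕ r)
      ≡⟨ ∑-truncate {1} {suc p} t (s≤s z≤n) (λ r 0<r → trans
           (cong (_* alternating m r) (weight-zero p q r (subst (ℕ._< r) (sym p⊓q≡0) 0<r)))
           (ℚP.*-zeroˡ (alternating m r))) ⟩
    1ℚ * (1ℚ * (1ℚ * F)) + 0ℚ
      ≡⟨ solve 1 (λ f → con 1ℚ :* (con 1ℚ :* (con 1ℚ :* f)) :+ con 0ℚ := f :* con 1ℚ) refl F ⟩
    F * 1ℚ ∎)
    where
    F : ℚ
    F = fromℕ (m !)
    t : ℕ → ℚ
    t r = weight p q r * alternating m r

  -- Gosper's algorithm gives t_0 + … + t_{r-1} = - r (n - r) t_r / (p q) for the summand t_r;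
  -- here q is suc q and n - r is written as q + s.
  gosper : ∀ p q {m} → p ℕ.+ suc q ≡ suc m → ∀ r s → r ℕ.+ s ≡ p →
    fromℕ p * fromℕ (suc q) * ∑[ i < r ] (weight p (suc q) (toℕ i) * alternating m (toℕ i)) ≡
    - (fromℕ r * (fromℕ (suc q) + fromℕ s)) * (weight p (suc q) r * alternating m r)
  gosper p q {m} p+q≡n zero    s e = solve 4 (λ p q s t →
      p :* q :* con 0ℚ := :- (con 0ℚ :* (q :+ s)) :* t) refl
    (fromℕ p) (fromℕ (suc q)) (fromℕ s) (weight p (suc q) 0 * alternating m 0)
  gosper p q {m} p+q≡n (suc r) s e = begin
    P * Q * ∑[ i < suc r ] t (toℕ i)
      ≡⟨ cong (P * Q *_) (∑-last r t) ⟩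
    P * Q * (∑[ i < r ] t (toℕ i) + t r)
      ≡⟨ ℚP.*-distribˡ-+ (P * Q) (∑[ i < r ] t (toℕ i)) (t r) ⟩
    P * Q * ∑[ i < r ] t (toℕ i) + P * Q * t r
      ≡⟨ cong₂ _+_ (gosper p q p+q≡n r (suc s) (trans (ℕP.+-suc r s) e)) (cong (λ z → z * Q * t r) P≡) ⟩
    -- With n = p + q, pq - r(n-r) = (p-r)(q-r), and these two factors advance both binomial
    -- coefficients of the weight to r + 1.
    - (R * (Q + S′)) * t r + (R + S′) * Q * t r
      ≡⟨ solve 6 (λ r s q c d w →
           :- (r :* (q :+ s)) :* (c :* d :* w) :+ (r :+ s) :* q :* (c :* d :* w) :=
           (r :+ s :- r) :* c :* ((q :- r) :* d) :* w) refl R S′ Q c d w ⟩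
    (R + S′ - R) * c * ((Q - R) * d) * w
      ≡⟨ cong (λ z → (z - R) * c * ((Q - R) * d) * w) P≡ ⟨
    (P - R) * c * ((Q - R) * d) * w
      ≡⟨ cong₂ (λ u v → u * v * w) (descentℚ p r) (descentℚ (suc q) r) ⟨
    R′ * c′ * (R′ * d′) * w
      ≡⟨ solve 4 (λ r c d w → r :* c :* (r :* d) :* w := :- (r :* (c :* d)) :* :- (r :* w)) refl R′ c′ d′ w ⟩
    - (R′ * (c′ * d′)) * - (R′ * w)
      ≡⟨ cong (- (R′ * (c′ * d′)) *_) (alternating-suc r<m) ⟨
    - (R′ * (c′ * d′)) * (fromℕ (m ∸ r) * w′)
      ≡⟨ cong (λ z → - (R′ * (c′ * d′)) * (z * w′)) (trans (cong fromℕ m∸r≡) (fromℕ-+ (suc q) s)) ⟩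
    - (R′ * (c′ * d′)) * ((Q + S) * w′)
      ≡⟨ solve 5 (λ r c d x w → :- (r :* (c :* d)) :* (x :* w) := :- (r :* x) :* (c :* d :* w)) refl
           R′ c′ d′ (Q + S) w′ ⟩
    - (R′ * (Q + S)) * t (suc r) ∎
    where
    t : ℕ → ℚ
    t i = weight p (suc q) i * alternating m i
    P Q R R′ S S′ c c′ d d′ w w′ : ℚ
    P = fromℕ p
    Q = fromℕ (suc q)
    R = fromℕ r
    R′ = fromℕ (suc r)
    S = fromℕ s
    S′ = fromℕ (suc s)
    c = fromℕ (p C r)
    c′ = fromℕ (p C suc r)
    d = fromℕ (suc q C r)
    d′ = fromℕ (suc q C suc r)
    w = alternating m r
    w′ = alternating m (suc r)
    P≡ : P ≡ R + S′
    P≡ = trans (cong fromℕ (sym (trans (ℕP.+-suc r s) e))) (fromℕ-+ r (suc s))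
    regroup : ∀ r s q → r ℕ.+ (suc q ℕ.+ s) ≡ r ℕ.+ s ℕ.+ suc q
    regroup = ℕSolver.solve-∀
    m≡ : r ℕ.+ (suc q ℕ.+ s) ≡ m
    m≡ = trans (regroup r s q) (ℕP.suc-injective (trans (cong (ℕ._+ suc q) e) p+q≡n))
    m∸r≡ : m ∸ r ≡ suc q ℕ.+ s
    m∸r≡ = trans (cong (_∸ r) (sym m≡)) (ℕP.m+n∸m≡n r (suc q ℕ.+ s))
    r<m : suc r ≤ m
    r<m = subst (suc r ≤_) m≡ (ℕP.m<m+n r (s≤s z≤n))

  -- At k = 0 the upper parameter 1 - k cancels the lower parameter 1, leaving ₂F₁(-P,-Q;1-n;1) with
  -- P, Q positive and P + Q = n. Chu-Vandermonde predicts (1-P)_P / (1-n)_P = 0; here the value is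
  -- read off from the Gosper partial sum.
  hypergeometric-interior : ∀ p q {m} → suc p ℕ.+ suc q ≡ suc m → hypergeometric (suc m) (suc p) 0 ≡ 0ℚ
  hypergeometric-interior p q {m} p+q≡n =
    *-cancelˡ F ⦃ fromℕ-nonZero (m !) ⦃ m ℕP.!≢0 ⦄ ⦄
      (*-cancelˡ P ⦃ fromℕ-nonZero (suc p) ⦄ (*-cancelˡ Q ⦃ fromℕ-nonZero (suc q) ⦄ (begin
    Q * (P * (F * hypergeometric (suc m) (suc p) 0))
      ≡⟨ cong (λ z → Q * (P * z)) (hypergeometric-0 (suc p) (suc q) p+q≡n) ⟩
    Q * (P * ∑[ r ≤ suc p ] t (toℕ r))
      ≡⟨ cong (λ z → Q * (P * z)) (∑-last (suc p) t) ⟩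
    Q * (P * (∑[ r < suc p ] t (toℕ r) + t (suc p)))
      ≡⟨ solve 4 (λ q p s t → q :* (p :* (s :+ t)) := p :* q :* s :+ p :* q :* t) refl
           Q P (∑[ r < suc p ] t (toℕ r)) (t (suc p)) ⟩
    P * Q * ∑[ r < suc p ] t (toℕ r) + P * Q * t (suc p)
      -- At the upper end s = 0 and the factor r(n-r) equals `P * Q`, so the earlier terms sum to
      -- minus the last one.
      ≡⟨ cong (_+ P * Q * t (suc p)) (gosper (suc p) q p+q≡n (suc p) 0 (ℕP.+-identityʳ (suc p))) ⟩
    - (P * (Q + 0ℚ)) * t (suc p) + P * Q * t (suc p)
      ≡⟨ solve 4 (λ q p f t → :- (p :* (q :+ con 0ℚ)) :* t :+ p :* q :* t := q :* (p :* (f :* con 0ℚ))) refl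
           Q P F (t (suc p)) ⟩
    Q * (P * (F * 0ℚ)) ∎)))
    where
    t : ℕ → ℚ
    t r = weight (suc p) (suc q) r * alternating m r
    F P Q : ℚ
    F = fromℕ (m !)
    P = fromℕ (suc p)
    Q = fromℕ (suc q)

  -- The value 1 is reached as 1 + 0 when p or q is 0, and as 0 + 1 otherwise.
  binomial-zero : ∀ p q {m} → p ℕ.+ q ≡ suc m →
    binomial (suc m) p 0 + fromℕ (coeff⁻ p q (suc m)) ≡ fromℕ (coeff⁺ p q (suc m))
  binomial-zero p q {m} p+q≡n = trans
    (cong (_+ fromℕ (coeff⁻ p q (suc m))) (ℚP.*-identityˡ (hypergeometric (suc m) p 0)))
    (trans (value p q p+q≡n) (cong fromℕ (sym (coeff⁺-0 p q p+q≡n))))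
    where
    value : ∀ p q {m} → p ℕ.+ q ≡ suc m →
      hypergeometric (suc m) p 0 + fromℕ (coeff⁻ p q (suc m)) ≡ 1ℚ
    value zero    q       e = cong (_+ 0ℚ) (hypergeometric-edge 0 q e refl)
    value (suc p) zero    e = cong (_+ 0ℚ) (hypergeometric-edge (suc p) 0 e refl)
    value (suc p) (suc q) e = cong₂ (λ h c → h + fromℕ c) (hypergeometric-interior p q e) (coeff⁻-0 p q e)

  binomial-coeff : ∀ p q k j {m} → p ℕ.+ q ≡ suc m → k ℕ.+ j ≡ suc m →
    binomial (suc m) p k + fromℕ (coeff⁻ p q j) ≡ fromℕ (coeff⁺ p q j)
  binomial-coeff p q zero    j p+q≡n refl  = binomial-zero p q p+q≡n
  binomial-coeff p q (suc k) j p+q≡n k+j≡n = binomial-suc p q k j p+q≡n k+j≡n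

-- The recurrence and its solution over an arbitrary commutative ring.

module GeneratingFunction {c ℓ} (R : CommutativeRing c ℓ) where
  open CommutativeRing R hiding (zero)
  open FiniteSums +-commutativeMonoid
  open import Algebra.Properties.Semiring.Sum semiring using (*-distribˡ-sum)
  open import Algebra.Properties.CommutativeMonoid.Mult +-commutativeMonoid
  open import Algebra.Properties.Semiring.Mult semiring using (×-comm-*; ×-assoc-*)
  open import Algebra.Properties.Semiring.Exp semiring using (_^_; ^-congʳ)
  open import Algebra.Properties.CommutativeSemiring.Exp commutativeSemiring using (^-distrib-*)
  open import Algebra.Properties.Group +-group using (//-rightDividesˡ) renaming (∙-cancelʳ to +-cancelʳ)
  open import Algebra.Solver.Ring.NaturalCoefficients.Default commutativeSemiring
    using (solve; _:=_; _:+_; _:*_; con)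
  open import Relation.Binary.Reasoning.Setoid setoid
  import Algebra.Properties.CommutativeMonoid.Sum ℕP.+-0-commutativeMonoid as ℕΣ

  sum-×ˡ : ∀ n (t : ℕ → ℕ) z →
    ℕΣ.sum {n} (λ i → t (toℕ i)) × z ≈ ∑[ i < n ] (t (toℕ i) × z)
  sum-×ˡ zero    t z = refl
  sum-×ˡ (suc n) t z =
    trans (×-homo-+ z (t 0) _) (+-congˡ (sum-×ˡ n (λ i → t (suc i)) z))

  sum-×ʳ : ∀ n m (f : ℕ → Carrier) →
    m × ∑[ i < n ] f (toℕ i) ≈ ∑[ i < n ] (m × f (toℕ i))
  sum-×ʳ zero    zero    f = refl
  sum-×ʳ zero    (suc m) f = trans (+-identityˡ _) (sum-×ʳ zero m f)
  sum-×ʳ (suc n) m       f =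
    trans (×-distrib-+ (f 0) _ m) (+-congˡ (sum-×ʳ n m (λ i → f (suc i))))

  pairingᴿ : ℕ → ℕ → (ℕ → Carrier) → Carrier
  pairingᴿ p q f = ∑[ r ≤ p ] (((p C toℕ r) ℕ.* (q C toℕ r)) × f (toℕ r))

  pairingᴿ-cong : ∀ p q {f g : ℕ → Carrier} → (∀ r → r ≤ p → f r ≈ g r) →
    pairingᴿ p q f ≈ pairingᴿ p q g
  pairingᴿ-cong p q f≈g =
    ∑-cong (suc p) λ { r (s≤s r≤p) → ×-congʳ ((p C r) ℕ.* (q C r)) (f≈g r r≤p) }

  pairingᴿ-* : ∀ p q z (f : ℕ → Carrier) → pairingᴿ p q (λ r → z * f r) ≈ z * pairingᴿ p q f
  pairingᴿ-* p q z f = trans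
    (∑-cong (suc p) λ r _ → sym (×-comm-* ((p C r) ℕ.* (q C r)) z (f r)))
    (sym (*-distribˡ-sum {suc p} z (λ r → ((p C toℕ r) ℕ.* (q C toℕ r)) × f (toℕ r))))

  pairingᴿ-zeroˡ : ∀ q (f : ℕ → Carrier) → pairingᴿ 0 q f ≈ f 0
  pairingᴿ-zeroˡ q f = trans (+-identityʳ _) (×-homo-1 (f 0))

  pairingᴿ-zeroʳ : ∀ p (f : ℕ → Carrier) → pairingᴿ p 0 f ≈ f 0
  pairingᴿ-zeroʳ p f = begin
    1 × f 0 + ∑[ r < p ] (((p C suc (toℕ r)) ℕ.* 0) × f (suc (toℕ r)))
      ≈⟨ +-cong (×-homo-1 (f 0))
           (∑-zero p λ r → ×-congˡ {f (suc r)} (ℕP.*-zeroʳ (p C suc r))) ⟩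
    f 0 + 0#
      ≈⟨ +-identityʳ (f 0) ⟩
    f 0 ∎

  -- Let A = C(p+1,r+1), A' = C(p,r+1), and B, B' the same for q. By Pascal's rule AB - A'B - AB' +
  -- A'B' = (A-A')(B-B') = C(p,r) C(q,r), which accounts for the sum with `f` shifted by one.
  pairingᴿ-suc : ∀ p q (f : ℕ → Carrier) →
    pairingᴿ (suc p) (suc q) f + pairingᴿ p q f ≈
    (pairingᴿ p (suc q) f + pairingᴿ (suc p) q f) + pairingᴿ p q (λ r → f (suc r))
  pairingᴿ-suc p q f = begin
    (t + ∑ (w₁₁)) + pairingᴿ p q f
      ≈⟨ +-congˡ (shift q) ⟩
    (t + ∑ w₁₁) + (t + ∑ w₀₀)
      ≈⟨ solve 3 (λ t a b → (t :+ a) :+ (t :+ b) := (t :+ t) :+ (a :+ b)) refl t (∑ w₁₁) (∑ w₀₀) ⟩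
    (t + t) + (∑ w₁₁ + ∑ w₀₀)
      ≈⟨ +-congˡ (trans (sym (∑-distrib-+ {suc p} (λ r → w₁₁ (toℕ r)) (λ r → w₀₀ (toℕ r))))
           (trans (∑-cong (suc p) λ r _ → term r)
             (trans (∑-distrib-+ {suc p} (λ r → w₀₁ (toℕ r) + w₁₀ (toℕ r)) (λ r → w (toℕ r)))
               (+-congʳ (∑-distrib-+ {suc p} (λ r → w₀₁ (toℕ r)) (λ r → w₁₀ (toℕ r))))))) ⟩
    (t + t) + ((∑ w₀₁ + ∑ w₁₀) + ∑ w)
      ≈⟨ solve 4 (λ t a b c → (t :+ t) :+ ((a :+ b) :+ c) := ((t :+ a) :+ (t :+ b)) :+ c) refl
           t (∑ w₀₁) (∑ w₁₀) (∑ w) ⟩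
    ((t + ∑ w₀₁) + (t + ∑ w₁₀)) + ∑ w
      ≈⟨ +-congʳ (+-congʳ (shift (suc q))) ⟨
    (pairingᴿ p (suc q) f + (t + ∑ w₁₀)) + ∑ w ∎
    where
    t : Carrier
    t = 1 × f 0
    ∑ : (ℕ → Carrier) → Carrier
    ∑ g = ∑[ r ≤ p ] g (toℕ r)
    w w₀₀ w₀₁ w₁₀ w₁₁ : ℕ → Carrier
    w   r = ((p C r) ℕ.* (q C r)) × f (suc r)
    w₀₀ r = ((p C suc r) ℕ.* (q C suc r)) × f (suc r)
    w₀₁ r = ((p C suc r) ℕ.* (suc q C suc r)) × f (suc r)
    w₁₀ r = ((suc p C suc r) ℕ.* (q C suc r)) × f (suc r)
    w₁₁ r = ((suc p C suc r) ℕ.* (suc q C suc r)) × f (suc r)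
    shift : ∀ q → pairingᴿ p q f ≈ t + ∑[ r ≤ p ] (((p C suc (toℕ r)) ℕ.* (q C suc (toℕ r))) × f (suc (toℕ r)))
    shift q = ∑-shift p (λ r → ((p C r) ℕ.* (q C r)) × f r)
      (×-congˡ (≡.cong (ℕ._* (q C suc p)) (k>n⇒nCk≡0 (ℕP.n<1+n p))))
    identity : ∀ a a′ b b′ →
      (a ℕ.+ a′) ℕ.* (b ℕ.+ b′) ℕ.+ a′ ℕ.* b′ ≡
      (a′ ℕ.* (b ℕ.+ b′) ℕ.+ (a ℕ.+ a′) ℕ.* b′) ℕ.+ a ℕ.* b
    identity = ℕSolver.solve-∀
    weights : ∀ r →
      (suc p C suc r) ℕ.* (suc q C suc r) ℕ.+ (p C suc r) ℕ.* (q C suc r) ≡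
      ((p C suc r) ℕ.* (suc q C suc r) ℕ.+ (suc p C suc r) ℕ.* (q C suc r))
        ℕ.+ (p C r) ℕ.* (q C r)
    weights r = ≡.subst₂
      (λ P Q → P ℕ.* Q ℕ.+ (p C suc r) ℕ.* (q C suc r) ≡
               ((p C suc r) ℕ.* Q ℕ.+ P ℕ.* (q C suc r)) ℕ.+ (p C r) ℕ.* (q C r))
      (≡.sym (pascal p r)) (≡.sym (pascal q r))
      (identity (p C r) (p C suc r) (q C r) (q C suc r))
    term : ∀ r → w₁₁ r + w₀₀ r ≈ (w₀₁ r + w₁₀ r) + w r
    term r = begin
      w₁₁ r + w₀₀ r                                  ≈⟨ ×-homo-+ z a₁₁ a₀₀ ⟨
      (a₁₁ ℕ.+ a₀₀) × z                              ≈⟨ ×-congˡ {z} (weights r) ⟩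
      ((a₀₁ ℕ.+ a₁₀) ℕ.+ (p C r) ℕ.* (q C r)) × z    ≈⟨ ×-homo-+ z (a₀₁ ℕ.+ a₁₀) _ ⟩
      (a₀₁ ℕ.+ a₁₀) × z + w r                        ≈⟨ +-congʳ (×-homo-+ z a₀₁ a₁₀) ⟩
      (w₀₁ r + w₁₀ r) + w r                          ∎
      where
      z : Carrier
      z = f (suc r)
      a₀₀ a₀₁ a₁₀ a₁₁ : ℕ
      a₀₀ = (p C suc r) ℕ.* (q C suc r)
      a₀₁ = (p C suc r) ℕ.* (suc q C suc r)
      a₁₀ = (suc p C suc r) ℕ.* (q C suc r)
      a₁₁ = (suc p C suc r) ℕ.* (suc q C suc r)

  module _ (x y : Carrier) where

    Y : Carrier
    Y = 1# + y

    monomial : ℕ → ℕ → Carrier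
    monomial n r = y ^ r * Y ^ (n ∸ r)

    monomial-suc : ∀ n r → r ≤ n → monomial (suc n) r ≈ Y * monomial n r
    monomial-suc n r r≤n = begin
      y ^ r * Y ^ (suc n ∸ r)    ≈⟨ *-congˡ (^-congʳ Y (ℕP.+-∸-assoc 1 r≤n)) ⟩
      y ^ r * (Y * Y ^ (n ∸ r))  ≈⟨ solve 3 (λ a b c → a :* (b :* c) := b :* (a :* c)) refl
                                      (y ^ r) Y (Y ^ (n ∸ r)) ⟩
      Y * (y ^ r * Y ^ (n ∸ r))  ∎

    G : ℕ → ℕ → Carrier
    G p q = pairingᴿ p q (monomial (p ℕ.+ q))

    G-zeroˡ : ∀ q → G 0 q ≈ Y ^ q
    G-zeroˡ q = trans (pairingᴿ-zeroˡ q (monomial q)) (*-identityˡ (Y ^ q))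

    G-zeroʳ : ∀ p → G p 0 ≈ Y ^ p
    G-zeroʳ p = trans (pairingᴿ-zeroʳ p (monomial (p ℕ.+ 0)))
      (trans (*-identityˡ _) (^-congʳ Y (ℕP.+-identityʳ p)))

    -- For the monomials y^r Y^(p+q+2-r), `pairingᴿ-suc` puts Y² before G(p,q) on the left and yY on
    -- the right. Since Y² = Y + yY, cancelling yY G(p,q) leaves the coefficient Y.
    G-suc : ∀ p q → G (suc p) (suc q) + Y * G p q ≈ Y * (G p (suc q) + G (suc p) q)
    G-suc p q = +-cancelʳ (y * Y * G p q) _ _ (begin
      (G (suc p) (suc q) + Y * G p q) + y * Y * G p q
        ≈⟨ solve 3 (λ a g y → (a :+ (con 1 :+ y) :* g) :+ y :* (con 1 :+ y) :* g :=
                              a :+ (con 1 :+ y) :* ((con 1 :+ y) :* g)) refl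
             (G (suc p) (suc q)) (G p q) y ⟩
      G (suc p) (suc q) + Y * (Y * G p q)
        ≈⟨ +-congˡ E₀₀ ⟨
      pairingᴿ (suc p) (suc q) f + pairingᴿ p q f
        ≈⟨ pairingᴿ-suc p q f ⟩
      (pairingᴿ p (suc q) f + pairingᴿ (suc p) q f) + pairingᴿ p q (λ r → f (suc r))
        ≈⟨ +-cong (+-cong E₀₁ E₁₀) E ⟩
      (Y * G p (suc q) + Y * G (suc p) q) + y * Y * G p q
        ≈⟨ +-congʳ (distribˡ Y _ _) ⟨
      Y * (G p (suc q) + G (suc p) q) + y * Y * G p q ∎)
      where
      f : ℕ → Carrier
      f = monomial (suc p ℕ.+ suc q)
      E₀₁ : pairingᴿ p (suc q) f ≈ Y * G p (suc q)
      E₀₁ = trans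
        (pairingᴿ-cong p (suc q) λ r r≤p →
          monomial-suc (p ℕ.+ suc q) r (ℕP.≤-trans r≤p (ℕP.m≤m+n p (suc q))))
        (pairingᴿ-* p (suc q) Y (monomial (p ℕ.+ suc q)))
      drop : ∀ m {r} → r ≤ m → m ≤ p ℕ.+ suc q → f r ≈ Y * monomial (suc (p ℕ.+ q)) r
      drop m {r} r≤m m≤ rewrite ℕP.+-suc p q = monomial-suc (suc (p ℕ.+ q)) r (ℕP.≤-trans r≤m m≤)
      E₁₀ : pairingᴿ (suc p) q f ≈ Y * G (suc p) q
      E₁₀ = trans
        (pairingᴿ-cong (suc p) q λ r r≤p →
          drop (suc p) r≤p (ℕP.≤-trans (s≤s (ℕP.m≤m+n p q)) (ℕP.≤-reflexive (≡.sym (ℕP.+-suc p q)))))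
        (pairingᴿ-* (suc p) q Y (monomial (suc p ℕ.+ q)))
      E₀₀ : pairingᴿ p q f ≈ Y * (Y * G p q)
      E₀₀ = trans
        (pairingᴿ-cong p q λ r r≤p → trans
          (drop p r≤p (ℕP.m≤m+n p (suc q)))
          (*-congˡ (monomial-suc (p ℕ.+ q) r (ℕP.≤-trans r≤p (ℕP.m≤m+n p q)))))
        (trans (pairingᴿ-* p q Y (λ r → Y * monomial (p ℕ.+ q) r))
               (*-congˡ (pairingᴿ-* p q Y (monomial (p ℕ.+ q)))))
      E : pairingᴿ p q (λ r → f (suc r)) ≈ y * Y * G p q
      E = trans
        (pairingᴿ-cong p q λ r r≤p → begin
          y * y ^ r * Y ^ (p ℕ.+ suc q ∸ r)
            ≈⟨ *-assoc y (y ^ r) _ ⟩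
          y * monomial (p ℕ.+ suc q) r
            ≈⟨ *-congˡ (*-congˡ (^-congʳ Y (≡.cong (_∸ r) (ℕP.+-suc p q)))) ⟩
          y * monomial (suc (p ℕ.+ q)) r
            ≈⟨ *-congˡ (monomial-suc (p ℕ.+ q) r (ℕP.≤-trans r≤p (ℕP.m≤m+n p q))) ⟩
          y * (Y * monomial (p ℕ.+ q) r)
            ≈⟨ *-assoc y Y _ ⟨
          y * Y * monomial (p ℕ.+ q) r ∎)
        (pairingᴿ-* p q (y * Y) (monomial (p ℕ.+ q)))

    H : ℕ → Carrier
    H n = antidiagonal n (λ p q → x ^ p * G p q)

    antidiagonal-* : ∀ n z (f : ℕ → ℕ → Carrier) →
      antidiagonal n (λ i j → z * f i j) ≈ z * antidiagonal n f
    antidiagonal-* n z f = sym (*-distribˡ-sum {suc n} z (λ i → f (toℕ i) (n ∸ toℕ i)))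

    -- `G-suc` covers the terms with p, q ≥ 1. The ends have one predecessor each: p = 0 gains a
    -- factor Y and q = 0 a factor xY, and they complete the two copies of H(n+1).
    H-suc : ∀ n → H (suc (suc n)) + x * Y * H n ≈ (1# + x) * Y * H (suc n)
    H-suc n = begin
      H (suc (suc n)) + x * Y * H n
        ≈⟨ +-cong (+-cong first (trans (antidiagonal-last n (λ p q → x ^ suc p * G (suc p) q))
                                       (+-congˡ last)))
                  (sym (antidiagonal-* n (x * Y) (λ p q → x ^ p * G p q))) ⟩
      (Y * (1# * G 0 (suc n)) + (∑ h₁₁ + x * Y * (x ^ suc n * G (suc n) 0))) + ∑ h₀₀
        ≈⟨ solve 4 (λ a b c d → (a :+ (b :+ c)) :+ d := (a :+ (b :+ d)) :+ c) refl _ (∑ h₁₁) _ (∑ h₀₀) ⟩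
      (Y * (1# * G 0 (suc n)) + (∑ h₁₁ + ∑ h₀₀)) + x * Y * (x ^ suc n * G (suc n) 0)
        ≈⟨ +-congʳ (+-congˡ (begin
             ∑ h₁₁ + ∑ h₀₀                          ≈⟨ antidiagonal-+ n h₁₁ h₀₀ ⟨
             ∑ (λ p q → h₁₁ p q + h₀₀ p q)          ≈⟨ antidiagonal-cong n (λ p q _ → term p q) ⟩
             ∑ (λ p q → Y * h₁₀ p q + x * Y * h₀₁ p q)
               ≈⟨ antidiagonal-+ n (λ p q → Y * h₁₀ p q) (λ p q → x * Y * h₀₁ p q) ⟩
             ∑ (λ p q → Y * h₁₀ p q) + ∑ (λ p q → x * Y * h₀₁ p q)
               ≈⟨ +-cong (antidiagonal-* n Y h₁₀) (antidiagonal-* n (x * Y) h₀₁) ⟩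
             Y * ∑ h₁₀ + x * Y * ∑ h₀₁ ∎)) ⟩
      (Y * (1# * G 0 (suc n)) + (Y * ∑ h₁₀ + x * Y * ∑ h₀₁)) + x * Y * (x ^ suc n * G (suc n) 0)
        ≈⟨ solve 6 (λ x y a b c d →
             (y :* a :+ (y :* b :+ x :* y :* c)) :+ x :* y :* d :=
             y :* (a :+ b) :+ x :* y :* (c :+ d)) refl
             x Y (1# * G 0 (suc n)) (∑ h₁₀) (∑ h₀₁) (x ^ suc n * G (suc n) 0) ⟩
      Y * H (suc n) + x * Y * (∑ h₀₁ + x ^ suc n * G (suc n) 0)
        ≈⟨ +-congˡ (*-congˡ (antidiagonal-last n (λ p q → x ^ p * G p q))) ⟨
      Y * H (suc n) + x * Y * H (suc n)
        ≈⟨ solve 3 (λ x y h → y :* h :+ x :* y :* h := (con 1 :+ x) :* y :* h) refl x Y (H (suc n)) ⟩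
      (1# + x) * Y * H (suc n) ∎
      where
      ∑ : (ℕ → ℕ → Carrier) → Carrier
      ∑ = antidiagonal n
      h₀₀ h₀₁ h₁₀ h₁₁ : ℕ → ℕ → Carrier
      h₀₀ p q = x * Y * (x ^ p * G p q)
      h₀₁ p q = x ^ p * G p (suc q)
      h₁₀ p q = x ^ suc p * G (suc p) q
      h₁₁ p q = x ^ suc p * G (suc p) (suc q)
      first : 1# * G 0 (suc (suc n)) ≈ Y * (1# * G 0 (suc n))
      first = begin
        1# * G 0 (suc (suc n))    ≈⟨ *-identityˡ _ ⟩
        G 0 (suc (suc n))         ≈⟨ G-zeroˡ (suc (suc n)) ⟩
        Y * Y ^ suc n             ≈⟨ *-congˡ (G-zeroˡ (suc n)) ⟨
        Y * G 0 (suc n)           ≈⟨ *-congˡ (*-identityˡ _) ⟨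
        Y * (1# * G 0 (suc n))    ∎
      last : x ^ suc (suc n) * G (suc (suc n)) 0 ≈ x * Y * (x ^ suc n * G (suc n) 0)
      last = begin
        x ^ suc (suc n) * G (suc (suc n)) 0    ≈⟨ *-congˡ (G-zeroʳ (suc (suc n))) ⟩
        x * x ^ suc n * (Y * Y ^ suc n)        ≈⟨ solve 4 (λ a b c d → a :* b :* (c :* d) := a :* c :* (b :* d)) refl
                                                    x (x ^ suc n) Y (Y ^ suc n) ⟩
        x * Y * (x ^ suc n * Y ^ suc n)        ≈⟨ *-congˡ (*-congˡ (G-zeroʳ (suc n))) ⟨
        x * Y * (x ^ suc n * G (suc n) 0)      ∎
      term : ∀ p q → h₁₁ p q + h₀₀ p q ≈ Y * h₁₀ p q + x * Y * h₀₁ p q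
      term p q = begin
        h₁₁ p q + h₀₀ p q
          ≈⟨ solve 5 (λ x y u a b → x :* u :* a :+ x :* y :* (u :* b) := x :* u :* (a :+ y :* b)) refl
               x Y (x ^ p) (G (suc p) (suc q)) (G p q) ⟩
        x ^ suc p * (G (suc p) (suc q) + Y * G p q)
          ≈⟨ *-congˡ (G-suc p q) ⟩
        x ^ suc p * (Y * (G p (suc q) + G (suc p) q))
          ≈⟨ solve 5 (λ x y u a b → x :* u :* (y :* (a :+ b)) := y :* (x :* u :* b) :+ x :* y :* (u :* a)) refl
               x Y (x ^ p) (G p (suc q)) (G (suc p) q) ⟩
        Y * h₁₀ p q + x * Y * h₀₁ p q ∎

    -- The relation hₙ₊₁ = αⁿ⁺¹ + βhₙ never divides by α - β, so a double root needs no separate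
    -- treatment.
    H-geometric : ∀ α β → α + β ≈ (1# + x) * Y → α * β ≈ x * Y →
      ∀ n → H (suc n) ≈ α ^ suc n + β * H n
    H-geometric α β α+β αβ zero = begin
      1# * G 0 1 + (x * 1# * G 1 0 + 0#)
        ≈⟨ +-cong (*-congˡ (G-zeroˡ 1)) (+-congʳ (*-congˡ (G-zeroʳ 1))) ⟩
      1# * (Y * 1#) + (x * 1# * (Y * 1#) + 0#)
        ≈⟨ solve 2 (λ x y → con 1 :* (y :* con 1) :+ (x :* con 1 :* (y :* con 1) :+ con 0) :=
                            (con 1 :+ x) :* y) refl x Y ⟩
      (1# + x) * Y
        ≈⟨ α+β ⟨
      α + β
        ≈⟨ solve 2 (λ a b → a :+ b := a :* con 1 :+ b :* (con 1 :* con 1 :+ con 0)) refl α β ⟩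
      α * 1# + β * (1# * 1# + 0#)
        ≈⟨ +-congˡ (*-congˡ (+-congʳ (*-congˡ (G-zeroˡ 0)))) ⟨
      α * 1# + β * H 0 ∎
    H-geometric α β α+β αβ (suc n) = +-cancelʳ (x * Y * H n) _ _ (begin
      H (suc (suc n)) + x * Y * H n
        ≈⟨ H-suc n ⟩
      (1# + x) * Y * H (suc n)
        ≈⟨ *-congʳ α+β ⟨
      (α + β) * H (suc n)
        ≈⟨ distribʳ (H (suc n)) α β ⟩
      α * H (suc n) + β * H (suc n)
        ≈⟨ +-congʳ (*-congˡ (H-geometric α β α+β αβ n)) ⟩
      α * (α ^ suc n + β * H n) + β * H (suc n)
        ≈⟨ solve 5 (λ a b u h h′ → a :* (u :+ b :* h) :+ h′ := (a :* u :+ h′) :+ a :* b :* h) refl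
             α β (α ^ suc n) (H n) (β * H (suc n)) ⟩
      (α ^ suc (suc n) + β * H (suc n)) + α * β * H n
        ≈⟨ +-congˡ (*-congʳ αβ) ⟩
      (α ^ suc (suc n) + β * H (suc n)) + x * Y * H n ∎)

    -- The correction αβ hₙ₋₁ to αⁿ⁺¹ + βⁿ⁺¹, with h₋₁ = 0.
    H⁻ : ℕ → Carrier
    H⁻ zero    = 0#
    H⁻ (suc n) = x * Y * H n

    -- `H-geometric` is used twice: with the roots exchanged it absorbs βⁿ⁺¹ + αhₙ into hₙ₊₁, then
    -- in the given order it absorbs αⁿ⁺² + βhₙ₊₁.
    power-sum : ∀ α β → α + β ≈ (1# + x) * Y → α * β ≈ x * Y →
      ∀ n → (α ^ suc n + β ^ suc n) + H⁻ n ≈ H (suc n)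
    power-sum α β α+β αβ zero = begin
      (α * 1# + β * 1#) + 0#
        ≈⟨ solve 2 (λ a b → (a :* con 1 :+ b :* con 1) :+ con 0 :=
                            a :* con 1 :+ b :* (con 1 :* con 1 :+ con 0)) refl α β ⟩
      α * 1# + β * (1# * 1# + 0#)
        ≈⟨ +-congˡ (*-congˡ (+-congʳ (*-congˡ (G-zeroˡ 0)))) ⟨
      α * 1# + β * H 0
        ≈⟨ H-geometric α β α+β αβ zero ⟨
      H 1 ∎
    power-sum α β α+β αβ (suc n) = begin
      (α ^ suc (suc n) + β ^ suc (suc n)) + x * Y * H n
        ≈⟨ +-congˡ (*-congʳ αβ) ⟨
      (α ^ suc (suc n) + β ^ suc (suc n)) + α * β * H n
        ≈⟨ solve 5 (λ a b u v h → (u :+ b :* v) :+ a :* b :* h := u :+ b :* (v :+ a :* h)) refl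
             α β (α ^ suc (suc n)) (β ^ suc n) (H n) ⟩
      α ^ suc (suc n) + β * (β ^ suc n + α * H n)
        ≈⟨ +-congˡ (*-congˡ (H-geometric β α (trans (+-comm β α) α+β) (trans (*-comm β α) αβ) n)) ⟨
      α ^ suc (suc n) + β * H (suc n)
        ≈⟨ H-geometric α β α+β αβ (suc n) ⟨
      H (suc (suc n)) ∎

    -- Expansion of `H` and `H⁻` in powers of x and y.

    binomial-expansion⁻ : ∀ N m →
      antidiagonal (suc m) (λ k j → (N C⁻ j) × y ^ k) ≈
      antidiagonal m (λ k j → (N C j) × y ^ k)
    binomial-expansion⁻ N m = trans (antidiagonal-last m (λ k j → (N C⁻ j) × y ^ k)) (+-identityʳ _)

    -- Pascal's rule leads from (N+1,r) to (N,r+1) and, on an antidiagonal shorter by one, to (N,r).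
    -- Together they contribute y + 1 = Y times y^r Y^N.
    binomial-expansion : ∀ N r {n} → N ℕ.+ r ≡ n →
      antidiagonal n (λ k j → (N C j) × y ^ k) ≈ y ^ r * Y ^ N
    binomial-expansion zero    zero    ≡.refl =
      solve 0 (con 1 :+ con 0 :+ con 0 := con 1 :* con 1) refl
    binomial-expansion zero    (suc r) ≡.refl = begin
      antidiagonal (suc r) (λ k j → (0 C j) × y ^ k)
        ≈⟨ antidiagonal-last r (λ k j → (0 C j) × y ^ k) ⟩
      antidiagonal r (λ _ _ → 0#) + 1 × y ^ suc r
        ≈⟨ +-cong (∑-zero (suc r) λ _ → refl) (+-identityʳ _) ⟩
      0# + y ^ suc r
        ≈⟨ +-identityˡ _ ⟩
      y ^ suc r
        ≈⟨ *-identityʳ _ ⟨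
      y ^ suc r * 1# ∎
    binomial-expansion (suc N) r       ≡.refl = begin
      antidiagonal n (λ k j → (suc N C j) × y ^ k)
        ≈⟨ antidiagonal-cong n (λ k j _ →
             trans (×-congˡ {y ^ k} (pascal⁻ N j)) (×-homo-+ (y ^ k) (N C j) (N C⁻ j))) ⟩
      antidiagonal n (λ k j → (N C j) × y ^ k + (N C⁻ j) × y ^ k)
        ≈⟨ antidiagonal-+ n (λ k j → (N C j) × y ^ k) (λ k j → (N C⁻ j) × y ^ k) ⟩
      antidiagonal n (λ k j → (N C j) × y ^ k) + antidiagonal n (λ k j → (N C⁻ j) × y ^ k)
        ≈⟨ +-cong (binomial-expansion N (suc r) (ℕP.+-suc N r))
                  (trans (binomial-expansion⁻ N (N ℕ.+ r)) (binomial-expansion N r ≡.refl)) ⟩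
      y ^ suc r * Y ^ N + y ^ r * Y ^ N
        ≈⟨ solve 3 (λ y a b → y :* a :* b :+ a :* b := a :* ((con 1 :+ y) :* b)) refl
             y (y ^ r) (Y ^ N) ⟩
      y ^ r * Y ^ suc N ∎
      where
      n : ℕ
      n = suc N ℕ.+ r

    antidiagonal-pairing : ∀ n p q (h : ℕ → ℕ → ℕ) →
      antidiagonal n (λ k j → pairing p q (λ r → h r j) × y ^ k) ≈
      pairingᴿ p q (λ r → antidiagonal n (λ k j → h r j × y ^ k))
    antidiagonal-pairing n p q h = begin
      antidiagonal n (λ k j → pairing p q (λ r → h r j) × y ^ k)
        ≈⟨ antidiagonal-cong n (λ k j _ → trans
             (sum-×ˡ (suc p) (λ r → w r ℕ.* h r j) (y ^ k))
             (∑-cong (suc p) λ r _ → sym (×-assocˡ (y ^ k) (w r) (h r j)))) ⟩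
      antidiagonal n (λ k j → ∑[ r ≤ p ] (w (toℕ r) × (h (toℕ r) j × y ^ k)))
        ≈⟨ ∑-comm {suc n} {suc p} (λ k r → w (toℕ r) × (h (toℕ r) (n ∸ toℕ k) × y ^ toℕ k)) ⟩
      ∑[ r ≤ p ] antidiagonal n (λ k j → w (toℕ r) × (h (toℕ r) j × y ^ k))
        ≈⟨ ∑-cong (suc p) (λ r _ → sum-×ʳ (suc n) (w r) (λ k → h r (n ∸ k) × y ^ k)) ⟨
      pairingᴿ p q (λ r → antidiagonal n (λ k j → h r j × y ^ k)) ∎
      where
      w : ℕ → ℕ
      w r = (p C r) ℕ.* (q C r)

    coeff⁺-sum : ∀ p q {n} → p ℕ.+ q ≡ n →
      antidiagonal n (λ k j → coeff⁺ p q j × y ^ k) ≈ G p q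
    coeff⁺-sum p q ≡.refl = trans
      (antidiagonal-pairing (p ℕ.+ q) p q (λ r j → (p ℕ.+ q ∸ r) C j))
      (pairingᴿ-cong p q λ r r≤p →
        binomial-expansion (p ℕ.+ q ∸ r) r (ℕP.m∸n+n≡m (ℕP.≤-trans r≤p (ℕP.m≤m+n p q))))

    coeff⁻-sum : ∀ p q {m} → p ℕ.+ q ≡ m →
      antidiagonal (suc (suc m)) (λ k j → coeff⁻ (suc p) (suc q) j × y ^ k) ≈ Y * G p q
    coeff⁻-sum p q {m} ≡.refl = begin
      antidiagonal (suc (suc m)) (λ k j → coeff⁻ (suc p) (suc q) j × y ^ k)
        ≈⟨ antidiagonal-pairing (suc (suc m)) p q (λ r j → (p ℕ.+ suc q ∸ r) C⁻ j) ⟩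
      pairingᴿ p q (λ r → antidiagonal (suc (suc m)) (λ k j → ((p ℕ.+ suc q ∸ r) C⁻ j) × y ^ k))
        ≈⟨ pairingᴿ-cong p q (λ r r≤p → term r (ℕP.≤-trans r≤p (ℕP.m≤m+n p q))) ⟩
      pairingᴿ p q (λ r → Y * monomial m r)
        ≈⟨ pairingᴿ-* p q Y (monomial m) ⟩
      Y * G p q ∎
      where
      term : ∀ r → r ≤ m →
        antidiagonal (suc (suc m)) (λ k j → ((p ℕ.+ suc q ∸ r) C⁻ j) × y ^ k) ≈ Y * monomial m r
      term r r≤m rewrite ℕP.+-suc p q = trans
        (binomial-expansion⁻ (suc m ∸ r) (suc m))
        (trans (binomial-expansion (suc m ∸ r) r (ℕP.m∸n+n≡m (ℕP.m≤n⇒m≤1+n r≤m)))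
               (monomial-suc m r r≤m))

    double-sum : ∀ n (h : ℕ → ℕ → ℕ → ℕ) →
      antidiagonal n (λ k j → antidiagonal n (λ p q → h p q j × 1# * x ^ p * y ^ k)) ≈
      antidiagonal n (λ p q → x ^ p * antidiagonal n (λ k j → h p q j × y ^ k))
    double-sum n h = begin
      antidiagonal n (λ k j → antidiagonal n (λ p q → h p q j × 1# * x ^ p * y ^ k))
        ≈⟨ ∑-comm {suc n} {suc n} (λ k p →
             h (toℕ p) (n ∸ toℕ p) (n ∸ toℕ k) × 1# * x ^ toℕ p * y ^ toℕ k) ⟩
      antidiagonal n (λ p q → antidiagonal n (λ k j → h p q j × 1# * x ^ p * y ^ k))
        ≈⟨ antidiagonal-cong n (λ p q _ → trans
             (antidiagonal-cong n (λ k j _ → term (h p q j) (x ^ p) (y ^ k)))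
             (antidiagonal-* n (x ^ p) (λ k j → h p q j × y ^ k))) ⟩
      antidiagonal n (λ p q → x ^ p * antidiagonal n (λ k j → h p q j × y ^ k)) ∎
      where
      term : ∀ m u v → m × 1# * u * v ≈ u * (m × v)
      term m u v = begin
        m × 1# * u * v     ≈⟨ solve 3 (λ a u v → a :* u :* v := u :* (a :* v)) refl (m × 1#) u v ⟩
        u * (m × 1# * v)   ≈⟨ *-congˡ (trans (×-assoc-* m 1# v) (×-congʳ m (*-identityˡ v))) ⟩
        u * (m × v)        ∎

    coeff⁺-double-sum : ∀ n →
      antidiagonal n (λ k j → antidiagonal n (λ p q → coeff⁺ p q j × 1# * x ^ p * y ^ k)) ≈ H n
    coeff⁺-double-sum n = trans (double-sum n coeff⁺)
      (antidiagonal-cong n λ p q p+q≡n → *-congˡ {x ^ p} (coeff⁺-sum p q p+q≡n))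

    -- `coeff⁻` vanishes when p or q is 0. Restarting the sum at p = q = 1 supplies the factor x,
    -- and `coeff⁻-sum` the factor Y.
    coeff⁻-double-sum : ∀ n →
      antidiagonal (suc n)
        (λ k j → antidiagonal (suc n) (λ p q → coeff⁻ p q j × 1# * x ^ p * y ^ k)) ≈ H⁻ n
    coeff⁻-double-sum n = trans (double-sum (suc n) coeff⁻) (reduce n)
      where
      summand : ℕ → ℕ → ℕ → Carrier
      summand n p q = x ^ p * antidiagonal (suc n) (λ k j → coeff⁻ p q j × y ^ k)
      boundaryˡ : ∀ n q → summand n 0 q ≈ 0#
      boundaryˡ n q = trans (*-congˡ (∑-zero (suc (suc n)) λ _ → refl)) (zeroʳ _)
      boundaryʳ : ∀ n p → summand n p 0 ≈ 0#
      boundaryʳ n zero    = boundaryˡ n 0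
      boundaryʳ n (suc p) = trans (*-congˡ (∑-zero (suc (suc n)) λ _ → refl)) (zeroʳ _)
      reduce : ∀ n → antidiagonal (suc n) (summand n) ≈ H⁻ n
      reduce zero    = trans (+-cong (boundaryˡ 0 1) (trans (+-identityʳ _) (boundaryʳ 0 1)))
                             (+-identityˡ 0#)
      reduce (suc m) = begin
        summand (suc m) 0 (suc (suc m)) + antidiagonal (suc m) (λ p q → summand (suc m) (suc p) q)
          ≈⟨ +-cong (boundaryˡ (suc m) (suc (suc m)))
               (antidiagonal-last m (λ p q → summand (suc m) (suc p) q)) ⟩
        0# + (antidiagonal m (λ p q → summand (suc m) (suc p) (suc q)) + summand (suc m) (suc (suc m)) 0)
          ≈⟨ +-identityˡ _ ⟩
        antidiagonal m (λ p q → summand (suc m) (suc p) (suc q)) + summand (suc m) (suc (suc m)) 0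
          ≈⟨ trans (+-congˡ (boundaryʳ (suc m) (suc (suc m)))) (+-identityʳ _) ⟩
        antidiagonal m (λ p q → summand (suc m) (suc p) (suc q))
          ≈⟨ antidiagonal-cong m (λ p q p+q≡m → trans
               (*-congˡ (coeff⁻-sum p q p+q≡m))
               (solve 4 (λ x u y g → x :* u :* (y :* g) := x :* y :* (u :* g)) refl
                  x (x ^ p) Y (G p q))) ⟩
        antidiagonal m (λ p q → x * Y * (x ^ p * G p q))
          ≈⟨ antidiagonal-* m (x * Y) (λ p q → x ^ p * G p q) ⟩
        x * Y * H m ∎

    -- The coefficients `b` stay abstract, so the hypergeometric sum enters only through one linear
    -- relation. Adding `H⁻ n` to both sides reduces the claim to `power-sum`.
    generating-function : ∀ n (b : ℕ → ℕ → Carrier) →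
      (∀ p q k j → p ℕ.+ q ≡ suc n → k ℕ.+ j ≡ suc n →
        b p k + coeff⁻ p q j × 1# ≈ coeff⁺ p q j × 1#) →
      ∀ α β → α + β ≈ (1# + x) * Y → α * β ≈ x * Y →
      antidiagonal (suc n) (λ k _ → antidiagonal (suc n) (λ p _ → b p k * x ^ p * y ^ k)) ≈
      α ^ suc n + β ^ suc n
    generating-function n b b-coeff α β α+β αβ = +-cancelʳ (H⁻ n) _ _ (begin
      ∑ (λ k _ → ∑ (λ p _ → b p k * x ^ p * y ^ k)) + H⁻ n
        ≈⟨ +-congˡ (coeff⁻-double-sum n) ⟨
      ∑ (λ k _ → ∑ (λ p _ → b p k * x ^ p * y ^ k))
        + ∑ (λ k j → ∑ (λ p q → coeff⁻ p q j × 1# * x ^ p * y ^ k))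
        ≈⟨ antidiagonal-+ (suc n) (λ k _ → ∑ (λ p _ → b p k * x ^ p * y ^ k))
             (λ k j → ∑ (λ p q → coeff⁻ p q j × 1# * x ^ p * y ^ k)) ⟨
      ∑ (λ k j → ∑ (λ p _ → b p k * x ^ p * y ^ k)
                   + ∑ (λ p q → coeff⁻ p q j × 1# * x ^ p * y ^ k))
        ≈⟨ antidiagonal-cong (suc n) (λ k j k+j≡n → trans
             (sym (antidiagonal-+ (suc n) (λ p _ → b p k * x ^ p * y ^ k)
                     (λ p q → coeff⁻ p q j × 1# * x ^ p * y ^ k)))
             (antidiagonal-cong (suc n) (λ p q p+q≡n → term p q k j p+q≡n k+j≡n))) ⟩
      ∑ (λ k j → ∑ (λ p q → coeff⁺ p q j × 1# * x ^ p * y ^ k))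
        ≈⟨ coeff⁺-double-sum (suc n) ⟩
      H (suc n)
        ≈⟨ power-sum α β α+β αβ n ⟨
      (α ^ suc n + β ^ suc n) + H⁻ n ∎)
      where
      ∑ : (ℕ → ℕ → Carrier) → Carrier
      ∑ = antidiagonal (suc n)
      term : ∀ p q k j → p ℕ.+ q ≡ suc n → k ℕ.+ j ≡ suc n →
        b p k * x ^ p * y ^ k + coeff⁻ p q j × 1# * x ^ p * y ^ k ≈
        coeff⁺ p q j × 1# * x ^ p * y ^ k
      term p q k j p+q≡n k+j≡n = trans
        (solve 4 (λ a b u v → a :* u :* v :+ b :* u :* v := (a :+ b) :* u :* v) refl
           (b p k) (coeff⁻ p q j × 1#) (x ^ p) (y ^ k))
        (*-congʳ (*-congʳ (b-coeff p q k j p+q≡n k+j≡n)))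

    -- The two roots, with `h` and `f` standing for ½ and 4.

    module _ (h f s : Carrier) (h+h : h + h ≈ 1#) (hhf : h * h * f ≈ 1#)
      (s² : s ^ 2 ≈ (1# + x) ^ 2 * Y ^ 2 - f * x * Y) where

      S t : Carrier
      S = (1# + x) * Y
      t = S - s

      t+s : t + s ≈ S
      t+s = //-rightDividesˡ s S

      root-sum : h * (S + s) + h * t ≈ S
      root-sum = begin
        h * (S + s) + h * t  ≈⟨ solve 4 (λ h u s t → h :* (u :+ s) :+ h :* t :=
                                                     h :* (u :+ (t :+ s))) refl h S s t ⟩
        h * (S + (t + s))    ≈⟨ *-congˡ (+-congˡ t+s) ⟩
        h * (S + S)          ≈⟨ solve 2 (λ h u → h :* (u :+ u) := (h :+ h) :* u) refl h S ⟩
        (h + h) * S          ≈⟨ *-congʳ h+h ⟩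
        1# * S               ≈⟨ *-identityˡ S ⟩
        S                    ∎

      -- This is S² - s². With s² added and S written as t + s, it becomes the square of t + s,
      -- within reach of a solver without negatives.
      discriminant : (S + s) * t ≈ f * x * Y
      discriminant = +-cancelʳ (s ^ 2) _ _ (begin
        (S + s) * t + s ^ 2                        ≈⟨ +-congʳ (*-congʳ (+-congʳ t+s)) ⟨
        ((t + s) + s) * t + s * (s * 1#)           ≈⟨ solve 2 (λ s t →
                                                        ((t :+ s) :+ s) :* t :+ s :* (s :* con 1) :=
                                                        (t :+ s) :* (t :+ s)) refl s t ⟩
        (t + s) * (t + s)                          ≈⟨ *-cong t+s t+s ⟩
        (1# + x) * Y * ((1# + x) * Y)              ≈⟨ solve 2 (λ u v → u :* v :* (u :* v) :=
                                                        u :* (u :* con 1) :* (v :* (v :* con 1)))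
                                                        refl (1# + x) Y ⟩
        (1# + x) ^ 2 * Y ^ 2                       ≈⟨ //-rightDividesˡ (f * x * Y) _ ⟨
        ((1# + x) ^ 2 * Y ^ 2 - f * x * Y) + f * x * Y  ≈⟨ +-comm _ _ ⟩
        f * x * Y + ((1# + x) ^ 2 * Y ^ 2 - f * x * Y)  ≈⟨ +-congˡ s² ⟨
        f * x * Y + s ^ 2                          ∎)

      root-product : h * (S + s) * (h * t) ≈ x * Y
      root-product = begin
        h * (S + s) * (h * t)  ≈⟨ solve 3 (λ h u t → h :* u :* (h :* t) := h :* h :* (u :* t)) refl
                                    h (S + s) t ⟩
        h * h * ((S + s) * t)  ≈⟨ *-congˡ discriminant ⟩
        h * h * (f * x * Y)    ≈⟨ solve 4 (λ h f x y → h :* h :* (f :* x :* y) :=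
                                                       h :* h :* f :* (x :* y)) refl h f x Y ⟩
        h * h * f * (x * Y)    ≈⟨ *-congʳ hhf ⟩
        1# * (x * Y)           ≈⟨ *-identityˡ _ ⟩
        x * Y                  ∎

      scaled-powers : ∀ n →
        (h * (S + s)) ^ n + (h * t) ^ n ≈ h ^ n * ((S + s) ^ n + t ^ n)
      scaled-powers n = trans (+-cong (^-distrib-* h (S + s) n) (^-distrib-* h t n))
                              (sym (distribˡ (h ^ n) _ _))

-- Specialisation to the complex numbers.

module _ where
  open ℂ hiding (zero)
  open ≡ using () renaming (refl to ≡-refl; cong to ≡-cong; sym to ≡-sym; trans to ≡-trans)
  open import Algebra.Properties.Semiring.Mult semiring using (_×_)
  open FiniteSums +-commutativeMonoid using (∑-zero)

  fromℚ-cong : ∀ {a b} → a ≡ b → fromℚ a ≈ fromℚ b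
  fromℚ-cong ≡-refl = refl

  fromℚ-+ : ∀ a b → fromℚ (a ℚ.+ b) ≈ fromℚ a + fromℚ b
  fromℚ-+ a b = ≃-pointwise (λ _ → ≡-refl) , ≃-pointwise (λ _ → ≡-refl)

  fromℚ-* : ∀ a b → fromℚ (a ℚ.* b) ≈ fromℚ a * fromℚ b
  fromℚ-* a b =
      ≃-pointwise (λ _ → ≡-sym (ℚP.+-identityʳ (a ℚ.* b)))
    , ≃-pointwise (λ _ → ≡-sym (≡.cong₂ ℚ._+_ (ℚP.*-zeroʳ a) (ℚP.*-zeroˡ b)))

  fromℚ-fromℕ : ∀ n → fromℚ (fromℕ n) ≈ n × 1#
  fromℚ-fromℕ zero    = refl
  fromℚ-fromℕ (suc n) = trans (fromℚ-cong (fromℕ-suc n))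
    (trans (fromℚ-+ 1ℚ (fromℕ n)) (+-congˡ {1#} (fromℚ-fromℕ n)))

  ½+½ : fromℚ ½ + fromℚ ½ ≈ 1#
  ½+½ = sym (fromℚ-+ ½ ½)

  ½*½*4 : fromℚ ½ * fromℚ ½ * fromℚ (fromℕ 4) ≈ 1#
  ½*½*4 = sym (trans (fromℚ-* (½ ℚ.* ½) (fromℕ 4)) (*-congʳ {fromℚ (fromℕ 4)} (fromℚ-* ½ ½)))

  fromℚ-binomial : ∀ n p q k j → p ℕ.+ q ≡ suc n → k ℕ.+ j ≡ suc n →
    fromℚ (binomial (suc n) p k) + coeff⁻ p q j × 1# ≈ coeff⁺ p q j × 1#
  fromℚ-binomial n p q k j p+q≡n k+j≡n = trans
    (+-congˡ {fromℚ (binomial (suc n) p k)} (sym (fromℚ-fromℕ (coeff⁻ p q j))))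
    (trans (sym (fromℚ-+ (binomial (suc n) p k) (fromℕ (coeff⁻ p q j))))
      (trans (fromℚ-cong (binomial-coeff p q k j p+q≡n k+j≡n)) (fromℚ-fromℕ (coeff⁺ p q j))))

  binomial-vanishes : ∀ n p k x y → suc n ≤ k → fromℚ (binomial n p k) * x ^ p * y ^ k ≈ 0#
  binomial-vanishes n p k x y n<k = trans
    (*-congʳ {y ^ k} (trans (*-congʳ {x ^ p} (fromℚ-cong (≡-trans
      (≡-cong (λ c → fromℕ c ℚ.* hypergeometric n p k) (k>n⇒nCk≡0 n<k))
      (ℚP.*-zeroˡ (hypergeometric n p k))))) (zeroˡ (x ^ p))))
    (zeroˡ (y ^ k))

  row-vanishes : ∀ n k x y → suc n ≤ k →
    ∑[ p ≤ n ] (fromℚ (binomial n (toℕ p) k) * x ^ toℕ p * y ^ k) ≈ 0#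
  row-vanishes n k x y n<k = ∑-zero (suc n) λ p → binomial-vanishes n p k x y n<k

open ℂ using (_≈_; _+_; _-_; _*_; _^_; 1#; sum⁺-syntax)

theorem2 : (n : ℕ) .⦃ _ : NonZero n ⦄ (x y s : ℂ) →
    s ^ 2 ≈ (1# + x) ^ 2 * (1# + y) ^ 2 - fromℚ (fromℕ 4) * x * (1# + y) →
    (λ k → ∑[ p ≤ n ] (fromℚ (binomial n (toℕ p) k) * x ^ toℕ p * y ^ k))
    SumsTo
    fromℚ ½ ^ n * (((1# + x) * (1# + y) + s) ^ n + ((1# + x) * (1# + y) - s) ^ n)
theorem2 zero    x y s s² = contradiction ≡.refl (ℕ.≢-nonZero⁻¹ zero)
theorem2 (suc n) x y s s² =
    -- The cutoff is one more than the exponent `suc n`, so k runs from 0 to that exponent and both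
    -- sums are `antidiagonal (suc n)` with the second index ignored.
    suc (suc n)
  , (λ k n<k → row-vanishes (suc n) k x y n<k)
  , ℂ.trans
      (generating-function x y n (λ p k → fromℚ (binomial (suc n) p k)) (fromℚ-binomial n)
        α β (root-sum x y h f s ½+½ ½*½*4 s²) (root-product x y h f s ½+½ ½*½*4 s²))
      (scaled-powers x y h f s ½+½ ½*½*4 s² (suc n))
  where
  open GeneratingFunction ℂ-commutativeRing
  h f α β : ℂ
  h = fromℚ ½
  f = fromℚ (fromℕ 4)
  α = h * ((1# + x) * (1# + y) + s)
  β = h * ((1# + x) * (1# + y) - s)
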